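{- Let $N\geq 2$ be even and $M_2=N/2$. For any non-zero choice of $(b_1,b_2)\in\mathbb{Z}_N^2$ with $\gcd(b_1,b_2,M_2)=1$, the linear code $C$ over $\mathbb{Z}_N$ generated by the rows of $$\begin{pmatrix} M_2 & 0 & M_2 & b_1 & -b_1 \\ {} M_2 & M_2 & 0 & b_2 & -b_2 \end{pmatrix}$$ is either a direct sum or it is isomorphic to the code generated by the rows of $$g=\begin{pmatrix} M_2 & M_2 & 0 & 0 & 0 \\ {} M_2 & 0 & M_2 & 1 & N-1 \end{pmatrix}.$$ The simplex $\Delta_C$ corresponding to the latter code has $h^*(\Delta_C,t)=\left(\tfrac{3N}{2}-1\right)t^2+\tfrac N2t+1$.
   Context: $\mathbb{Z}_N=\mathbb{Z}/N\mathbb{Z}$, with elements identified with the representatives $0,\dots,N-1$. A linear code of length $n$ over $\mathbb{Z}_N$ is a submodule of $\mathbb{Z}_N^n$. Two codes over the same $\mathbb{Z}_N$ and of the same length are isomorphic if they coincide after a permutation of coordinates. Direct sum: for codes $C_1$ over $\mathbb{Z}_{N_1}$ and $C_2$ over $\mathbb{Z}_{N_2}$, of lengths $\ge1$, with $L=\operatorname{lcm}(N_1,N_2)$, $C_1\oplus C_2$ is the code over $\mathbb{Z}_L$ consisting of all concatenations $\frac{L}{N_1}c_1\,|\,\frac{L}{N_2}c_2$, $c_i\in C_i$. A code is a direct sum if it is isomorphic to some $C_1\oplus C_2$. Simplex of a code: for a code $C\subseteq\mathbb{Z}_N^{d+1}$ all of whose words have coordinate sum $0\bmod N$, let $M=\pi^{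 -1}(C)\subseteq\mathbb{Z}^{d+1}$ with $\pi:\mathbb{Z}^{d+1}\to\mathbb{Z}_N^{d+1}$ the reduction map, and $\Delta_C=\operatorname{conv}(Ne_0,\dots,Ne_d)$, viewed as a $d$-dimensional lattice simplex with respect to the affine lattice $\operatorname{aff}(Ne_0,\dots,Ne_d)\cap M$. For a $d$-dimensional lattice polytope $\Delta$ with lattice $M'$, $h^*(\Delta,t)$ is defined by $1+\sum_{k\ge1}|k\Delta\cap M'|t^k=h^*(\Delta,t)/(1-t)^{d+1}$; for $\Delta_C$ one has $h^*(\Delta_C,t)=\sum_{c\in C}t^{\frac1N\sum_i c_i}$. -}

module Defs where

open import Algebra.Properties.CommutativeMonoid.Sum as Sum using ()
open import Data.Fin.Base using (Fin; zero; suc; toℕ; fromℕ<)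
open import Data.Fin.Permutation using (Permutation′; _⟨$⟩ʳ_)
open import Data.Fin.Properties using (toℕ-injective; toℕ-fromℕ<)
open import Data.Integer.Base as ℤ using (ℤ; +_; 0ℤ; 1ℤ; -1ℤ)
open import Data.Integer.DivMod using (_%ℕ_; n%ℕd<d)
import Data.Integer.Properties as ℤ
open import Data.List.Base as List using (List)
open import Data.List.Membership.Propositional using () renaming (_∈_ to _∈ˡ_)
open import Data.List.Relation.Unary.Unique.Propositional using (Unique)
open import Data.Nat.Base as ℕ using (ℕ; zero; suc; NonZero; _+_; _*_; _∸_)
open import Data.Nat.DivMod using (_/_; _%_; _mod_; m%n<n; m/n*n≡m; %-distribˡ-+;
  %-distribˡ-*; m≡m%n+[m/n]*n; [m+kn]%n≡m%n; m%n%n≡m%n)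
open import Data.Nat.Divisibility using (_∣_)
open import Data.Nat.LCM using (lcm; m∣lcm[m,n]; n∣lcm[m,n])
import Data.Nat.Properties as ℕ
open import Data.Nat.Tactic.RingSolver using (solve-∀)
open import Data.Product.Base using (Σ-syntax; ∃-syntax; _×_; _,_)
open import Data.Rational.Base as ℚ using (ℚ; 0ℚ; 1ℚ)
import Data.Rational.Properties as ℚ
open import Data.Vec.Base as Vec using (Vec; []; _∷_; _++_; lookup; map; replicate;
  tabulate; zipWith; _[_]≔_)
open import Data.Vec.Properties using (zipWith-++; map-++; map-replicate)
open import Function.Bundles using (_⇔_)
open import Level using (0ℓ)
open import Relation.Binary.PropositionalEquality using (_≡_; refl; sym; trans; cong; cong₂;
  module ≡-Reasoning)
open import Relation.Unary using (Pred; _∩_)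

private
  variable
    d m n : ℕ
    N N₁ N₂ : ℕ

-- ℤ_N is represented by Fin N, i.e. by the representatives 0, …, N-1.

residue : .{{_ : NonZero N}} → ℤ → Fin N
residue {N} i = fromℕ< (n%ℕd<d i N)

module _ .{{_ : NonZero N}} where

  infixl 6 _+ₘ_
  infixl 7 _*ₘ_

  0ₘ : Fin N
  0ₘ = 0 mod N

  _+ₘ_ _*ₘ_ : Fin N → Fin N → Fin N
  a +ₘ b = (toℕ a + toℕ b) mod N
  a *ₘ b = (toℕ a * toℕ b) mod N

Word : ℕ → ℕ → Set
Word N n = Vec (Fin N) n

module _ .{{_ : NonZero N}} where

  infixl 6 _+ʷ_
  infixr 7 _*ʷ_

  0ʷ : Word N n
  0ʷ = replicate _ 0ₘ

  _+ʷ_ : Word N n → Word N n → Word N n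
  _+ʷ_ = zipWith _+ₘ_

  _*ʷ_ : Fin N → Word N n → Word N n
  a *ʷ w = map (a *ₘ_) w

record LinearCode (N n : ℕ) .{{_ : NonZero N}} : Set₁ where
  field
    Mem      : Pred (Word N n) 0ℓ
    0-closed : Mem 0ʷ
    +-closed : ∀ {v w} → Mem v → Mem w → Mem (v +ʷ w)
    *-closed : ∀ a {w} → Mem w → Mem (a *ʷ w)

open LinearCode public using (Mem)

module _ .{{_ : NonZero N}} where

  infix 4 _∈_ _≅_

  _∈_ : Word N n → LinearCode N n → Set
  w ∈ C = Mem C w

  data Span (rows : Vec (Word N n) m) : Pred (Word N n) 0ℓ where
    row  : ∀ i → Span rows (lookup rows i)
    zero : Span rows 0ʷ
    plus : ∀ {v w} → Span rows v → Span rows w → Span rows (v +ʷ w)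
    mult : ∀ a {w} → Span rows w → Span rows (a *ʷ w)

  generatedBy : Vec (Word N n) m → LinearCode N n
  generatedBy rows = record
    { Mem = Span rows ; 0-closed = zero ; +-closed = plus ; *-closed = mult }

  permute : Permutation′ n → Word N n → Word N n
  permute σ w = tabulate (λ i → lookup w (σ ⟨$⟩ʳ i))

  _≅_ : LinearCode N n → LinearCode N n → Set
  _≅_ {n} C D = Σ[ σ ∈ Permutation′ n ] (∀ w → w ∈ C ⇔ permute σ w ∈ D)

-- Multiplication by L/N, as a map from ℤ_N to ℤ_L.

scale : (L : ℕ) .{{_ : NonZero N}} .{{_ : NonZero L}} → Fin N → Fin L
scale {N} L c = (L / N * toℕ c) mod L

private
  module ScaleLemmas (N L : ℕ) .{{_ : NonZero N}} .{{_ : NonZero L}} (N∣L : N ∣ L) where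
    open ≡-Reasoning

    k : ℕ
    k = L / N

    k*N≡L : k * N ≡ L
    k*N≡L = m/n*n≡m N∣L

    k*-% : ∀ x → (k * (x % N)) % L ≡ (k * x) % L
    k*-% x = begin
      (k * (x % N)) % L                    ≡⟨ [m+kn]%n≡m%n (k * (x % N)) (x / N) L ⟨
      (k * (x % N) + x / N * L) % L        ≡⟨ cong (λ l → (k * (x % N) + x / N * l) % L) k*N≡L ⟨
      (k * (x % N) + x / N * (k * N)) % L  ≡⟨ cong (_% L) (rearr k (x % N) (x / N) N) ⟩
      (k * (x % N + x / N * N)) % L        ≡⟨ cong (λ y → (k * y) % L) (m≡m%n+[m/n]*n x N) ⟨
      (k * x) % L                          ∎
      where
      rearr : ∀ a b c e → a * b + c * (a * e) ≡ a * (b + c * e)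
      rearr = solve-∀

    toℕ-mod : ∀ M .{{_ : NonZero M}} x → toℕ (x mod M) ≡ x % M
    toℕ-mod M x = toℕ-fromℕ< (m%n<n x M)

    scale-0 : scale L (0ₘ {N}) ≡ 0ₘ
    scale-0 = toℕ-injective (begin
      toℕ (scale L (0ₘ {N}))     ≡⟨ toℕ-mod L _ ⟩
      (k * toℕ (0ₘ {N})) % L     ≡⟨ cong (λ y → (k * y) % L) (toℕ-mod N 0) ⟩
      (k * (0 % N)) % L          ≡⟨ k*-% 0 ⟩
      (k * 0) % L                ≡⟨ cong (_% L) (ℕ.*-zeroʳ k) ⟩
      0 % L                      ≡⟨ toℕ-mod L 0 ⟨
      toℕ (0ₘ {L})               ∎)

    scale-+ : ∀ (a b : Fin N) → scale L (a +ₘ b) ≡ scale L a +ₘ scale L b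
    scale-+ a b = toℕ-injective (begin
      toℕ (scale L (a +ₘ b))                       ≡⟨ toℕ-mod L _ ⟩
      (k * toℕ (a +ₘ b)) % L                       ≡⟨ cong (λ y → (k * y) % L) (toℕ-mod N _) ⟩
      (k * ((toℕ a + toℕ b) % N)) % L              ≡⟨ k*-% (toℕ a + toℕ b) ⟩
      (k * (toℕ a + toℕ b)) % L                    ≡⟨ cong (_% L) (ℕ.*-distribˡ-+ k (toℕ a) (toℕ b)) ⟩
      (k * toℕ a + k * toℕ b) % L                  ≡⟨ %-distribˡ-+ (k * toℕ a) (k * toℕ b) L ⟩
      ((k * toℕ a) % L + (k * toℕ b) % L) % L      ≡⟨ cong (_% L) (cong₂ _+_ (toℕ-mod L _) (toℕ-mod L _)) ⟨
      (toℕ (scale {N} L a) + toℕ (scale L b)) % L  ≡⟨ toℕ-mod L _ ⟨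
      toℕ (scale L a +ₘ scale L b)                 ∎)

    scale-* : ∀ (r : Fin L) (a : Fin N) → scale L ((toℕ r mod N) *ₘ a) ≡ r *ₘ scale L a
    scale-* r a = toℕ-injective (begin
      toℕ (scale L ((toℕ r mod N) *ₘ a))           ≡⟨ toℕ-mod L _ ⟩
      (k * toℕ ((toℕ r mod N) *ₘ a)) % L           ≡⟨ cong (λ y → (k * y) % L) (toℕ-mod N _) ⟩
      (k * ((toℕ (toℕ r mod N) * toℕ a) % N)) % L  ≡⟨ k*-% (toℕ (toℕ r mod N) * toℕ a) ⟩
      (k * (toℕ (toℕ r mod N) * toℕ a)) % L        ≡⟨ cong (λ y → (k * (y * toℕ a)) % L) (toℕ-mod N _) ⟩
      (k * (toℕ r % N * toℕ a)) % L                ≡⟨ cong (_% L) (rearr k (toℕ r % N) (toℕ a)) ⟩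
      (k * (toℕ r % N) * toℕ a) % L                ≡⟨ %-distribˡ-* (k * (toℕ r % N)) (toℕ a) L ⟩
      ((k * (toℕ r % N)) % L * (toℕ a % L)) % L    ≡⟨ cong (λ y → (y * (toℕ a % L)) % L) (k*-% (toℕ r)) ⟩
      ((k * toℕ r) % L * (toℕ a % L)) % L          ≡⟨ %-distribˡ-* (k * toℕ r) (toℕ a) L ⟨
      (k * toℕ r * toℕ a) % L                      ≡⟨ cong (_% L) (swap k (toℕ r) (toℕ a)) ⟩
      (toℕ r * (k * toℕ a)) % L                    ≡⟨ %-distribˡ-* (toℕ r) (k * toℕ a) L ⟩
      (toℕ r % L * ((k * toℕ a) % L)) % L          ≡⟨ cong (λ y → (toℕ r % L * y) % L) (m%n%n≡m%n (k * toℕ a) L) ⟨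
      (toℕ r % L * ((k * toℕ a) % L % L)) % L      ≡⟨ %-distribˡ-* (toℕ r) ((k * toℕ a) % L) L ⟨
      (toℕ r * ((k * toℕ a) % L)) % L              ≡⟨ cong (λ y → (toℕ r * y) % L) (toℕ-mod L _) ⟨
      (toℕ r * toℕ (scale L a)) % L                ≡⟨ toℕ-mod L _ ⟨
      toℕ (r *ₘ scale L a)                         ∎)
      where
      rearr : ∀ x y z → x * (y * z) ≡ x * y * z
      rearr = solve-∀
      swap : ∀ x y z → x * y * z ≡ y * (x * z)
      swap = solve-∀

    scaleʷ-0 : map (scale L) (0ʷ {N} {n}) ≡ 0ʷ
    scaleʷ-0 {n} = trans (map-replicate (scale L) 0ₘ n) (cong (replicate n) scale-0)

    scaleʷ-+ : ∀ (v w : Word N n) → map (scale L) (v +ʷ w) ≡ map (scale L) v +ʷ map (scale L) w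
    scaleʷ-+ []      []      = refl
    scaleʷ-+ (a ∷ v) (b ∷ w) = cong₂ _∷_ (scale-+ a b) (scaleʷ-+ v w)

    scaleʷ-* : ∀ r (w : Word N n) → map (scale L) ((toℕ r mod N) *ʷ w) ≡ r *ʷ map (scale L) w
    scaleʷ-* r []      = refl
    scaleʷ-* r (a ∷ w) = cong₂ _∷_ (scale-* r a) (scaleʷ-* r w)

  replicate-++ : ∀ {A : Set} m n (x : A) → replicate m x ++ replicate n x ≡ replicate (m + n) x
  replicate-++ zero    n x = refl
  replicate-++ (suc m) n x = cong (x ∷_) (replicate-++ m n x)

module _ .{{_ : NonZero N₁}} .{{_ : NonZero N₂}} .{{_ : NonZero (lcm N₁ N₂)}} where

  private
    L = lcm N₁ N₂
    module S₁ = ScaleLemmas N₁ L (m∣lcm[m,n] N₁ N₂)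
    module S₂ = ScaleLemmas N₂ L (n∣lcm[m,n] N₁ N₂)

  infixr 5 _⊕_

  _⊕_ : LinearCode N₁ m → LinearCode N₂ n → LinearCode (lcm N₁ N₂) (m + n)
  _⊕_ {m = m} {n = n} C₁ C₂ = record
    { Mem = λ w → ∃[ c₁ ] ∃[ c₂ ]
        (c₁ ∈ C₁ × c₂ ∈ C₂ × w ≡ map (scale (lcm N₁ N₂)) c₁ ++ map (scale (lcm N₁ N₂)) c₂)
    ; 0-closed = 0ʷ {n = m} , 0ʷ {n = n} , C₁.0-closed , C₂.0-closed ,
        sym (trans (cong₂ _++_ (S₁.scaleʷ-0 {m}) (S₂.scaleʷ-0 {n})) (replicate-++ m n 0ₘ))
    ; +-closed = λ { (a₁ , a₂ , p₁ , p₂ , e) (b₁ , b₂ , q₁ , q₂ , f) →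
        a₁ +ʷ b₁ , a₂ +ʷ b₂ , C₁.+-closed p₁ q₁ , C₂.+-closed p₂ q₂ ,
        trans (trans (cong₂ _+ʷ_ e f) (zipWith-++ _+ₘ_ (map (scale L) a₁) _ _ _))
              (sym (cong₂ _++_ (S₁.scaleʷ-+ a₁ b₁) (S₂.scaleʷ-+ a₂ b₂))) }
    ; *-closed = λ { r (a₁ , a₂ , p₁ , p₂ , e) →
        (toℕ r mod N₁) *ʷ a₁ , (toℕ r mod N₂) *ʷ a₂ , C₁.*-closed (toℕ r mod N₁) p₁ , C₂.*-closed (toℕ r mod N₂) p₂ ,
        trans (trans (cong (r *ʷ_) e) (map-++ (r *ₘ_) (map (scale L) a₁) _))
              (sym (cong₂ _++_ (S₁.scaleʷ-* r a₁) (S₂.scaleʷ-* r a₂))) }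
    }
    where
    module C₁ = LinearCode C₁
    module C₂ = LinearCode C₂

-- The indices force the modulus of the decomposed code to be lcm N₁ N₂ and its
-- length to be n₁ + n₂; both summands have positive length.

data IsDirectSum : ∀ {N n} .{{_ : NonZero N}} → LinearCode N n → Set₁ where
  directSum : ∀ {N₁ N₂ n₁ n₂}
    .{{_ : NonZero N₁}} .{{_ : NonZero N₂}} .{{_ : NonZero (lcm N₁ N₂)}} →
    1 ℕ.≤ n₁ → 1 ℕ.≤ n₂ →
    (C : LinearCode (lcm N₁ N₂) (n₁ + n₂)) (C₁ : LinearCode N₁ n₁) (C₂ : LinearCode N₂ n₂) →
    C ≅ (C₁ ⊕ C₂) → IsDirectSum C

Point : ℕ → Set
Point n = Vec ℤ n

module _ where
  open Sum ℚ.+-0-commutativeMonoid using (sum)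

  IsAffineCombination : (Fin m → ℚ) → (Fin m → Point n) → Pred (Point n) 0ℓ
  IsAffineCombination {n = n} t v x =
    sum t ≡ 1ℚ ×
    ((j : Fin n) → lookup x j ℚ./ 1 ≡ sum (λ i → t i ℚ.* (lookup (v i) j ℚ./ 1)))

-- Integer points of the affine and convex hulls of finitely many integer points.
-- Rational coefficients suffice: a rational point of the real hull of rational
-- points is already a combination with rational coefficients.

Aff Conv : (Fin m → Point n) → Pred (Point n) 0ℓ
Aff  v x = ∃[ t ] IsAffineCombination t v x
Conv v x = ∃[ t ] ((∀ i → 0ℚ ℚ.≤ t i) × IsAffineCombination t v x)

-- A d-simplex with vertices in an affine lattice, given as a set of integer points.

record LatticeSimplex (d n : ℕ) : Set₁ where
  field
    vertex  : Fin (suc d) → Point n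
    lattice : Pred (Point n) 0ℓ

-- Dilating inside an affine lattice requires an origin in that lattice; vertex 0
-- is used. Another choice translates k Δ by a lattice vector.

dilate : ℕ → LatticeSimplex d n → Fin (suc d) → Point n
dilate k Δ i = zipWith (λ o x → o ℤ.+ + k ℤ.* (x ℤ.- o)) (vertex zero) (vertex i)
  where open LatticeSimplex Δ

latticePoints : ℕ → LatticeSimplex d n → Pred (Point n) 0ℓ
latticePoints k Δ = Conv (dilate k Δ) ∩ LatticeSimplex.lattice Δ

HasCardinality : {A : Set} → Pred A 0ℓ → ℕ → Set
HasCardinality {A} P c =
  Σ[ xs ∈ List A ] (Unique xs × (∀ x → x ∈ˡ xs ⇔ P x) × List.length xs ≡ c)

PowerSeries : Set
PowerSeries = ℕ → ℤ

module _ where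
  open Sum ℤ.+-0-commutativeMonoid using (sum)

  infixl 7 _⊛_
  infixr 8 _^ˢ_

  _⊛_ : PowerSeries → PowerSeries → PowerSeries
  (f ⊛ g) n = sum {n = suc n} (λ i → f (toℕ i) ℤ.* g (n ∸ toℕ i))

  fromCoefficients : List ℤ → PowerSeries
  fromCoefficients List.[]       _       = 0ℤ
  fromCoefficients (a List.∷ as) zero    = a
  fromCoefficients (a List.∷ as) (suc n) = fromCoefficients as n

  _^ˢ_ : PowerSeries → ℕ → PowerSeries
  f ^ˢ zero  = fromCoefficients (1ℤ List.∷ List.[])
  f ^ˢ suc k = f ⊛ f ^ˢ k

1-t : PowerSeries
1-t = fromCoefficients (1ℤ List.∷ -1ℤ List.∷ List.[])

-- The defining identity 1 + Σ_{k≥1} |k Δ ∩ M'| t^k = h / (1-t)^(d+1), multiplied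
-- out; h is listed from the constant coefficient upwards.

HasHStar : LatticeSimplex d n → List ℤ → Set
HasHStar {d} Δ h = Σ[ ehr ∈ (ℕ → ℕ) ]
  ( ehr 0 ≡ 1
  × (∀ k → 1 ℕ.≤ k → HasCardinality (latticePoints k Δ) (ehr k))
  × (∀ j → ((λ k → + ehr k) ⊛ 1-t ^ˢ suc d) j ≡ fromCoefficients h j))

module _ .{{_ : NonZero N}} where

  HasZeroSums : LinearCode N n → Set
  HasZeroSums C = ∀ w → w ∈ C → N ∣ Vec.sum (map toℕ w)

  π : Point n → Word N n
  π = map residue

  -- The zero-sum hypothesis is the condition under which the simplex of a code is
  -- defined; the data do not depend on it.

  simplexOf : (C : LinearCode N (suc d)) → HasZeroSums C → LatticeSimplex d (suc d)
  simplexOf {d} C _ = record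
    { vertex  = Ne
    ; lattice = Aff Ne ∩ (λ x → π x ∈ C)
    }
    where
    Ne : Fin (suc d) → Point (suc d)
    Ne i = replicate _ 0ℤ [ i ]≔ + N

module _ (N : ℕ) .{{_ : NonZero N}} where

  private
    M₂ : ℤ
    M₂ = + (N / 2)

  codeOf : Fin N → Fin N → LinearCode N 5
  codeOf b₁ b₂ = generatedBy
    ( map residue (M₂ ∷ 0ℤ ∷ M₂ ∷ + toℕ b₁ ∷ ℤ.- (+ toℕ b₁) ∷ [])
    ∷ map residue (M₂ ∷ M₂ ∷ 0ℤ ∷ + toℕ b₂ ∷ ℤ.- (+ toℕ b₂) ∷ [])
    ∷ [])

  codeG : LinearCode N 5
  codeG = generatedBy
    ( map residue (M₂ ∷ M₂ ∷ 0ℤ ∷ 0ℤ ∷ 0ℤ ∷ [])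
    ∷ map residue (M₂ ∷ 0ℤ ∷ M₂ ∷ 1ℤ ∷ + N ℤ.- 1ℤ ∷ [])
    ∷ [])

{-# OPTIONS --safe #-}
module Submission where

-- A word of the code generated by two rows of the given shape is determined by the parities of the
-- coefficients κ₁, κ₂ of the rows and by its fourth coordinate s. Since gcd(b₁, b₂, M₂) = 1, the only
-- relation between them is κ₁ b₁ + κ₂ b₂ ≡ s mod 2, so the code depends on b₁, b₂ mod 2 only. For
-- (0, 0) the first three coordinates are independent of the last two; (1, 0) is the code g; for
-- (0, 1) and (1, 1) a transposition of two of the first three coordinates leads to (1, 0).
--
-- A lattice point of the k-th dilate is, up to a translation, y = c + N z with c in the code and z a
-- vector of naturals whose entries sum to k - (Σ c)/N. There are as many such z as the coefficient of
-- t^k in t^((Σ c)/N) / (1 - t)^(d+1), which gives h* = Σ_c t^((Σ c)/N).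

open import Defs
open import Algebra.Bundles using (AbelianGroup; CommutativeRing)
import Algebra.Properties.Group as GroupProperties
import Algebra.Properties.Semiring.Sum as SemiringSum
open import Data.Empty using (⊥)
open import Data.Fin.Base using (Fin; zero; suc; toℕ; fromℕ<)
open import Data.Fin.Patterns using (0F; 1F; 2F)
open import Data.Fin.Permutation as Perm using (Permutation′; transpose)
open import Data.Fin.Properties using (toℕ-injective; toℕ-fromℕ<; toℕ<n)
open import Data.Integer.Base as ℤ using (ℤ; +_; 0ℤ; 1ℤ; -1ℤ)
open import Data.Integer.DivMod using (_/ℕ_; _%ℕ_; a≡a%ℕn+[a/ℕn]*n; n%ℕd<d)
import Data.Integer.Properties as ℤ
open import Data.Integer.Tactic.RingSolver using (solve-∀)
open import Data.List.Base as List using (List; []; _∷_; _++_; length; allFin; cartesianProduct)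
open import Data.List.Membership.Propositional using () renaming (_∈_ to _∈ˡ_)
open import Data.List.Membership.Propositional.Properties using (∈-map⁺; ∈-map⁻; ∈-++⁺ˡ; ∈-++⁺ʳ;
  ∈-++⁻; ∈-allFin; ∈-cartesianProduct⁺; ∈-cartesianProduct⁻)
open import Data.List.Properties using (length-map; length-++; length-tabulate)
open import Data.List.Relation.Unary.All as All using (All)
import Data.List.Relation.Unary.AllPairs as AllPairs
open import Data.List.Relation.Unary.Any using (here; there)
open import Data.List.Relation.Unary.Unique.Propositional using (Unique)
import Data.List.Relation.Unary.Unique.Propositional.Properties as Unique
open import Data.Nat.Base as ℕ using (ℕ; zero; suc; NonZero; _≤_; _<_; _*_; _∸_; s≤s; z≤n)
open import Data.Nat.Divisibility using (_∣_; divides; ∣-antisym; ∣-refl)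
open import Data.Nat.DivMod using (_/_; _%_; _mod_; m%n<n; m≡m%n+[m/n]*n; m/n*n≡m; m*n/n≡m; n/n≡1;
  m<n*o⇒m/o<n; /-monoˡ-≤)
open import Data.Nat.GCD using (gcd; gcd-GCD; module Bézout)
open import Data.Nat.LCM using (lcm; lcm-least; m∣lcm[m,n])
import Data.Nat.Properties as ℕ
open import Data.Nat.Tactic.RingSolver using () renaming (solve-∀ to ℕsolve-∀)
open import Data.Product.Base using (Σ-syntax; ∃-syntax; _×_; _,_; proj₁; proj₂)
open import Data.Rational.Base as ℚ using (ℚ; 0ℚ; 1ℚ; toℚᵘ)
import Data.Rational.Properties as ℚ
open import Data.Rational.Unnormalised.Base as ℚᵘ using (mkℚᵘ; *≡*)
import Data.Rational.Unnormalised.Properties as ℚᵘ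
open import Data.Sum.Base using (_⊎_; inj₁; inj₂)
open import Data.Vec.Base as Vec using (Vec; []; _∷_; lookup; map; replicate; tabulate; zipWith;
  _[_]≔_) renaming (_++_ to _++ᵛ_)
open import Data.Vec.Properties using (lookup-map; lookup-replicate; lookup-zipWith;
  lookup∘tabulate; tabulate∘lookup; tabulate-cong; map-cong; map-id)
open import Function.Base using (_∘_; id)
open import Function.Bundles using (_⇔_; mk⇔; Equivalence)
open import Function.Construct.Composition using (_⇔-∘_)
open import Relation.Binary.PropositionalEquality using (_≡_; refl; sym; trans; cong; cong₂; subst;
  module ≡-Reasoning)
open import Relation.Nullary.Negation using (¬_; contradiction)

private
  variable
    d m n N : ℕ
    A : Set

module Σℤ = SemiringSum (CommutativeRing.semiring ℤ.+-*-commutativeRing)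
module Σℚ = SemiringSum (CommutativeRing.semiring ℚ.+-*-commutativeRing)
module ℤGroup = GroupProperties (AbelianGroup.group ℤ.+-0-abelianGroup)
module ℚGroup = GroupProperties ℚ.+-0-group

-- Residues and spans

remainder-unique : ∀ {r r′} q q′ → r < N → r′ < N →
  + r ℤ.+ q ℤ.* + N ≡ + r′ ℤ.+ q′ ℤ.* + N → r ≡ r′
remainder-unique {N} {r} {r′} q q′ r<N r′<N eq =
  ℤ.+-injective (ℤ.i-j≡0⇒i≡j (+ r) (+ r′) (trans diff (cong (ℤ._* + N) q′-q≡0)))
  where
  move : ∀ r r′ q q′ n → r ℤ.- r′ ≡ (r ℤ.+ q ℤ.* n) ℤ.- (r′ ℤ.+ q′ ℤ.* n) ℤ.+ (q′ ℤ.- q) ℤ.* n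
  move = solve-∀
  diff : + r ℤ.- + r′ ≡ (q′ ℤ.- q) ℤ.* + N
  diff = trans (move (+ r) (+ r′) q q′ (+ N))
    (trans (cong (ℤ._+ (q′ ℤ.- q) ℤ.* + N) (ℤ.i≡j⇒i-j≡0 eq)) (ℤ.+-identityˡ _))
  ∣q′-q∣*N<N : ℤ.∣ q′ ℤ.- q ∣ ℕ.* N < N
  ∣q′-q∣*N<N = begin-strict
    ℤ.∣ q′ ℤ.- q ∣ ℕ.* N       ≡⟨ ℤ.abs-* (q′ ℤ.- q) (+ N) ⟨
    ℤ.∣ (q′ ℤ.- q) ℤ.* + N ∣   ≡⟨ cong ℤ.∣_∣ diff ⟨
    ℤ.∣ + r ℤ.- + r′ ∣         ≡⟨ cong ℤ.∣_∣ (ℤ.m-n≡m⊖n r r′) ⟩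
    ℤ.∣ r ℤ.⊖ r′ ∣             ≤⟨ ℤ.∣m⊝n∣≤m⊔n r r′ ⟩
    r ℕ.⊔ r′                   <⟨ ℕ.⊔-lub r<N r′<N ⟩
    N                          ∎
    where open ℕ.≤-Reasoning
  q′-q≡0 : q′ ℤ.- q ≡ 0ℤ
  q′-q≡0 = ℤ.∣i∣≡0⇒i≡0 (ℕ.n<1⇒n≡0 (ℕ.*-cancelʳ-< N _ 1
    (subst (ℤ.∣ q′ ℤ.- q ∣ ℕ.* N <_) (sym (ℕ.*-identityˡ N)) ∣q′-q∣*N<N)))

module _ .{{_ : NonZero N}} where

  toℕ-residue : ∀ i → toℕ (residue {N} i) ≡ i %ℕ N
  toℕ-residue i = toℕ-fromℕ< (n%ℕd<d i N)

  toℕ-residue-unique : ∀ {i r} q → r < N → i ≡ + r ℤ.+ q ℤ.* + N → toℕ (residue {N} i) ≡ r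
  toℕ-residue-unique {i} q r<N eq = trans (toℕ-residue i)
    (remainder-unique (i /ℕ N) q (n%ℕd<d i N) r<N (trans (sym (a≡a%ℕn+[a/ℕn]*n i N)) eq))

  residue-unique : ∀ {i} (r : Fin N) q → i ≡ + toℕ r ℤ.+ q ℤ.* + N → residue i ≡ r
  residue-unique r q eq = toℕ-injective (toℕ-residue-unique q (toℕ<n r) eq)

  residue-toℕ : ∀ (r : Fin N) → residue (+ toℕ r) ≡ r
  residue-toℕ r = residue-unique {+ toℕ r} r 0ℤ (sym (ℤ.+-identityʳ _))

  residue-quotient : ∀ i → i ≡ + toℕ (residue {N} i) ℤ.+ (i /ℕ N) ℤ.* + N
  residue-quotient i = trans (a≡a%ℕn+[a/ℕn]*n i N)
    (cong (λ r → + r ℤ.+ (i /ℕ N) ℤ.* + N) (sym (toℕ-residue i)))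

  residue-cong : ∀ i j q → i ≡ j ℤ.+ q ℤ.* + N → residue {N} i ≡ residue j
  residue-cong i j q eq = residue-unique (residue j) (j /ℕ N ℤ.+ q)
    (trans eq (trans (cong (ℤ._+ q ℤ.* + N) (residue-quotient j))
      (rearr (+ toℕ (residue {N} j)) (j /ℕ N) q (+ N))))
    where
    rearr : ∀ r p q n → r ℤ.+ p ℤ.* n ℤ.+ q ℤ.* n ≡ r ℤ.+ (p ℤ.+ q) ℤ.* n
    rearr = solve-∀

  mod≡residue : ∀ x → x mod N ≡ residue (+ x)
  mod≡residue x = toℕ-injective (trans (toℕ-fromℕ< (m%n<n x N)) (sym (toℕ-residue (+ x))))

  residue-+ : ∀ i j → residue {N} i +ₘ residue j ≡ residue (i ℤ.+ j)
  residue-+ i j = trans (mod≡residue _) (sym (residue-cong (i ℤ.+ j)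
    (+ (toℕ (residue {N} i) ℕ.+ toℕ (residue {N} j))) (i /ℕ N ℤ.+ j /ℕ N)
    (trans (cong₂ ℤ._+_ (residue-quotient i) (residue-quotient j))
    (trans (rearr (+ toℕ (residue {N} i)) (+ toℕ (residue {N} j)) (i /ℕ N) (j /ℕ N) (+ N))
      (cong (ℤ._+ (i /ℕ N ℤ.+ j /ℕ N) ℤ.* + N) (sym (ℤ.pos-+ (toℕ (residue {N} i)) _)))))))
    where
    rearr : ∀ r s p q n → r ℤ.+ p ℤ.* n ℤ.+ (s ℤ.+ q ℤ.* n) ≡ r ℤ.+ s ℤ.+ (p ℤ.+ q) ℤ.* n
    rearr = solve-∀

  residue-* : ∀ i j → residue {N} i *ₘ residue j ≡ residue (i ℤ.* j)
  residue-* i j = trans (mod≡residue _) (sym (residue-cong (i ℤ.* j)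
    (+ (toℕ (residue {N} i) ℕ.* toℕ (residue {N} j))) Q
    (trans (cong₂ ℤ._*_ (residue-quotient i) (residue-quotient j))
    (trans (rearr r s p q (+ N))
      (cong (ℤ._+ Q ℤ.* + N) (sym (ℤ.pos-* (toℕ (residue {N} i)) _)))))))
    where
    r = + toℕ (residue {N} i)
    s = + toℕ (residue {N} j)
    p = i /ℕ N
    q = j /ℕ N
    Q = r ℤ.* q ℤ.+ p ℤ.* (s ℤ.+ q ℤ.* + N)
    rearr : ∀ r s p q n → (r ℤ.+ p ℤ.* n) ℤ.* (s ℤ.+ q ℤ.* n) ≡ r ℤ.* s ℤ.+ (r ℤ.* q ℤ.+ p ℤ.* (s ℤ.+ q ℤ.* n)) ℤ.* n
    rearr = solve-∀

infixl 6 _+ᵖ_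
infixr 7 _*ᵖ_

0ᵖ : Point n
0ᵖ = replicate _ 0ℤ

_+ᵖ_ : Point n → Point n → Point n
_+ᵖ_ = zipWith ℤ._+_

_*ᵖ_ : ℤ → Point n → Point n
k *ᵖ v = map (k ℤ.*_) v

combination : Vec ℤ m → Vec (Point n) m → Point n
combination []       []       = 0ᵖ
combination (k ∷ ks) (v ∷ vs) = k *ᵖ v +ᵖ combination ks vs

+ᵖ-identityˡ : ∀ (v : Point n) → 0ᵖ +ᵖ v ≡ v
+ᵖ-identityˡ []      = refl
+ᵖ-identityˡ (x ∷ v) = cong₂ _∷_ (ℤ.+-identityˡ x) (+ᵖ-identityˡ v)

+ᵖ-identityʳ : ∀ (v : Point n) → v +ᵖ 0ᵖ ≡ v
+ᵖ-identityʳ []      = refl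
+ᵖ-identityʳ (x ∷ v) = cong₂ _∷_ (ℤ.+-identityʳ x) (+ᵖ-identityʳ v)

*ᵖ-identityˡ : ∀ (v : Point n) → 1ℤ *ᵖ v ≡ v
*ᵖ-identityˡ []      = refl
*ᵖ-identityˡ (x ∷ v) = cong₂ _∷_ (ℤ.*-identityˡ x) (*ᵖ-identityˡ v)

*ᵖ-zeroˡ : ∀ (v : Point n) → 0ℤ *ᵖ v ≡ 0ᵖ
*ᵖ-zeroˡ []      = refl
*ᵖ-zeroˡ (x ∷ v) = cong₂ _∷_ (ℤ.*-zeroˡ x) (*ᵖ-zeroˡ v)

*ᵖ-zeroʳ : ∀ k → k *ᵖ 0ᵖ {n} ≡ 0ᵖ
*ᵖ-zeroʳ {zero}  k = refl
*ᵖ-zeroʳ {suc n} k = cong₂ _∷_ (ℤ.*-zeroʳ k) (*ᵖ-zeroʳ k)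

interchange : ∀ k l (v x y : Point n) →
  (k ℤ.+ l) *ᵖ v +ᵖ (x +ᵖ y) ≡ (k *ᵖ v +ᵖ x) +ᵖ (l *ᵖ v +ᵖ y)
interchange k l []      []      []      = refl
interchange k l (v ∷ vs) (x ∷ xs) (y ∷ ys) = cong₂ _∷_ (ring k l v x y) (interchange k l vs xs ys)
  where
  ring : ∀ k l v x y → (k ℤ.+ l) ℤ.* v ℤ.+ (x ℤ.+ y) ≡ k ℤ.* v ℤ.+ x ℤ.+ (l ℤ.* v ℤ.+ y)
  ring = solve-∀

*ᵖ-distrib : ∀ c k (v x : Point n) → c *ᵖ (k *ᵖ v +ᵖ x) ≡ (c ℤ.* k) *ᵖ v +ᵖ c *ᵖ x
*ᵖ-distrib c k []      []      = refl
*ᵖ-distrib c k (v ∷ vs) (x ∷ xs) = cong₂ _∷_ (ring c k v x) (*ᵖ-distrib c k vs xs)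
  where
  ring : ∀ c k v x → c ℤ.* (k ℤ.* v ℤ.+ x) ≡ c ℤ.* k ℤ.* v ℤ.+ c ℤ.* x
  ring = solve-∀

combination-0 : ∀ (vs : Vec (Point n) m) → combination 0ᵖ vs ≡ 0ᵖ
combination-0 []       = refl
combination-0 (v ∷ vs) = trans (cong₂ _+ᵖ_ (*ᵖ-zeroˡ v) (combination-0 vs)) (+ᵖ-identityˡ 0ᵖ)

combination-+ : ∀ ks ls (vs : Vec (Point n) m) →
  combination (ks +ᵖ ls) vs ≡ combination ks vs +ᵖ combination ls vs
combination-+ []       []       []       = sym (+ᵖ-identityˡ 0ᵖ)
combination-+ (k ∷ ks) (l ∷ ls) (v ∷ vs) =
  trans (cong ((k ℤ.+ l) *ᵖ v +ᵖ_) (combination-+ ks ls vs)) (interchange k l v _ _)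

combination-* : ∀ c ks (vs : Vec (Point n) m) →
  combination (c *ᵖ ks) vs ≡ c *ᵖ combination ks vs
combination-* c []       []       = sym (*ᵖ-zeroʳ c)
combination-* c (k ∷ ks) (v ∷ vs) =
  trans (cong ((c ℤ.* k) *ᵖ v +ᵖ_) (combination-* c ks vs)) (sym (*ᵖ-distrib c k v _))

combination-unit : ∀ i (vs : Vec (Point n) m) → combination (0ᵖ [ i ]≔ 1ℤ) vs ≡ lookup vs i
combination-unit zero    (v ∷ vs) =
  trans (cong₂ _+ᵖ_ (*ᵖ-identityˡ v) (combination-0 vs)) (+ᵖ-identityʳ v)
combination-unit (suc i) (v ∷ vs) =
  trans (cong₂ _+ᵖ_ (*ᵖ-zeroˡ v) (combination-unit i vs)) (+ᵖ-identityˡ _)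

module _ .{{_ : NonZero N}} where

  π-0 : π {N} (0ᵖ {n}) ≡ 0ʷ
  π-0 {zero}  = refl
  π-0 {suc n} = cong₂ _∷_ (sym (mod≡residue 0)) π-0

  π-+ : ∀ (v w : Point n) → π {N} (v +ᵖ w) ≡ π v +ʷ π w
  π-+ []      []      = refl
  π-+ (x ∷ v) (y ∷ w) = cong₂ _∷_ (sym (residue-+ x y)) (π-+ v w)

  π-* : ∀ k (v : Point n) → π {N} (k *ᵖ v) ≡ residue k *ʷ π v
  π-* k []      = refl
  π-* k (x ∷ v) = cong₂ _∷_ (sym (residue-* k x)) (π-* k v)

  span⇒combination : ∀ (rows : Vec (Point n) m) {w} → Span (map π rows) w →
    ∃[ ks ] w ≡ π {N} (combination ks rows)
  span⇒combination rows (row i) = 0ᵖ [ i ]≔ 1ℤ ,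
    trans (lookup-map i π rows) (cong π (sym (combination-unit i rows)))
  span⇒combination rows zero = 0ᵖ , trans (sym π-0) (cong π (sym (combination-0 rows)))
  span⇒combination rows (plus p q)
    with ks , refl ← span⇒combination rows p | ls , refl ← span⇒combination rows q =
    ks +ᵖ ls , trans (sym (π-+ _ _)) (cong π (sym (combination-+ ks ls rows)))
  span⇒combination rows (mult a p) with ks , refl ← span⇒combination rows p =
    + toℕ a *ᵖ ks , trans (cong (_*ʷ π (combination ks rows)) (sym (residue-toℕ a)))
      (trans (sym (π-* (+ toℕ a) _)) (cong π (sym (combination-* (+ toℕ a) ks rows))))

  combination⇒span : ∀ ks (rows : Vec (Point n) m) {l} {rows′ : Vec (Word N n) l} →
    (∀ i → Span rows′ (π (lookup rows i))) → Span rows′ (π (combination ks rows))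
  combination⇒span []       []         _ = subst (Span _) (sym π-0) zero
  combination⇒span (k ∷ ks) (v ∷ rows) f = subst (Span _)
    (sym (trans (π-+ _ _) (cong (_+ʷ _) (π-* k v))))
    (plus (mult (residue k) (f zero)) (combination⇒span ks rows (λ i → f (suc i))))

  span⇔combination : ∀ (rows : Vec (Point n) m) w →
    Span (map π rows) w ⇔ (∃[ ks ] w ≡ π {N} (combination ks rows))
  span⇔combination rows w = mk⇔ (span⇒combination rows)
    λ { (ks , refl) → combination⇒span ks rows
          (λ i → subst (Span (map π rows)) (lookup-map i π rows) (row i)) }

-- The codes up to isomorphism

bézout : ∀ m n → ∃[ x ] ∃[ y ] x ℤ.* + m ℤ.+ y ℤ.* + n ≡ + gcd m n
bézout m n with Bézout.identity (gcd-GCD m n)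
... | Bézout.+- x y eq = + x , ℤ.- + y , (begin
  + x ℤ.* + m ℤ.+ ℤ.- + y ℤ.* + n
    ≡⟨ cong (ℤ._+ ℤ.- + y ℤ.* + n) (trans (sym (ℤ.pos-* x m)) (cong +_ (sym eq))) ⟩
  + (gcd m n ℕ.+ y ℕ.* n) ℤ.+ ℤ.- + y ℤ.* + n  ≡⟨ cong (λ z → + gcd m n ℤ.+ z ℤ.+ ℤ.- + y ℤ.* + n) (ℤ.pos-* y n) ⟩
  + gcd m n ℤ.+ + y ℤ.* + n ℤ.+ ℤ.- + y ℤ.* + n ≡⟨ cancel (+ gcd m n) (+ y) (+ n) ⟩
  + gcd m n                                    ∎)
  where
  open ≡-Reasoning
  cancel : ∀ g y n → g ℤ.+ y ℤ.* n ℤ.+ ℤ.- y ℤ.* n ≡ g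
  cancel = solve-∀
... | Bézout.-+ x y eq = ℤ.- + x , + y , (begin
  ℤ.- + x ℤ.* + m ℤ.+ + y ℤ.* + n
    ≡⟨ cong (λ z → ℤ.- + x ℤ.* + m ℤ.+ z) (trans (sym (ℤ.pos-* y n)) (cong +_ (sym eq))) ⟩
  ℤ.- + x ℤ.* + m ℤ.+ + (gcd m n ℕ.+ x ℕ.* m)   ≡⟨ cong (λ z → ℤ.- + x ℤ.* + m ℤ.+ (+ gcd m n ℤ.+ z)) (ℤ.pos-* x m) ⟩
  ℤ.- + x ℤ.* + m ℤ.+ (+ gcd m n ℤ.+ + x ℤ.* + m) ≡⟨ cancel (+ gcd m n) (+ x) (+ m) ⟩
  + gcd m n                                     ∎)
  where
  open ≡-Reasoning
  cancel : ∀ g x m → ℤ.- x ℤ.* m ℤ.+ (g ℤ.+ x ℤ.* m) ≡ g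
  cancel = solve-∀

bézout₃ : ∀ b c m → gcd (gcd b c) m ≡ 1 →
  ∃[ u ] ∃[ v ] ∃[ t ] u ℤ.* + b ℤ.+ v ℤ.* + c ≡ 1ℤ ℤ.+ t ℤ.* + m
bézout₃ b c m gcd≡1
  with x , y , eq₁ ← bézout b c | z , t , eq₂ ← bézout (gcd b c) m =
  z ℤ.* x , z ℤ.* y , ℤ.- t , (begin
    z ℤ.* x ℤ.* + b ℤ.+ z ℤ.* y ℤ.* + c                    ≡⟨ rearr z x y t (+ b) (+ c) (+ m) ⟩
    z ℤ.* (x ℤ.* + b ℤ.+ y ℤ.* + c) ℤ.+ t ℤ.* + m ℤ.+ ℤ.- t ℤ.* + m
      ≡⟨ cong (λ g → z ℤ.* g ℤ.+ t ℤ.* + m ℤ.+ ℤ.- t ℤ.* + m) eq₁ ⟩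
    z ℤ.* + gcd b c ℤ.+ t ℤ.* + m ℤ.+ ℤ.- t ℤ.* + m        ≡⟨ cong (ℤ._+ ℤ.- t ℤ.* + m) (trans eq₂ (cong +_ gcd≡1)) ⟩
    1ℤ ℤ.+ ℤ.- t ℤ.* + m                                   ∎)
  where
  open ≡-Reasoning
  rearr : ∀ z x y t b c m → z ℤ.* x ℤ.* b ℤ.+ z ℤ.* y ℤ.* c ≡
    z ℤ.* (x ℤ.* b ℤ.+ y ℤ.* c) ℤ.+ t ℤ.* m ℤ.+ ℤ.- t ℤ.* m
  rearr = solve-∀

parity : ∀ b → ∃[ r ] ∃[ c ] (r ≡ 0ℤ ⊎ r ≡ 1ℤ) × + b ≡ r ℤ.+ c ℤ.* + 2
parity b with b % 2 | m%n<n b 2 | a≡a%ℕn+[a/ℕn]*n (+ b) 2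
... | 0 | _ | eq = 0ℤ , + b /ℕ 2 , inj₁ refl , eq
... | 1 | _ | eq = 1ℤ , + b /ℕ 2 , inj₂ refl , eq
... | suc (suc _) | s≤s (s≤s ()) | _

module _ .{{_ : NonZero N}} where

  involution-≅ : ∀ (σ : Permutation′ n) {C D : LinearCode N n} →
    (∀ w → permute σ (permute σ w) ≡ w) →
    (∀ w → w ∈ C → permute σ w ∈ D) → (∀ w → w ∈ D → permute σ w ∈ C) → C ≅ D
  involution-≅ σ {C} invol to from =
    σ , λ w → mk⇔ (to w) (λ p → subst (_∈ C) (invol w) (from (permute σ w) p))

  scale-id : ∀ (c : Fin N) → scale N c ≡ c
  scale-id c = trans (mod≡residue _)
    (trans (cong (λ k → residue (+ (k ℕ.* toℕ c))) (n/n≡1 N))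
      (trans (cong (λ x → residue (+ x)) (ℕ.*-identityˡ (toℕ c))) (residue-toℕ c)))

  map-scale-id : ∀ (w : Word N n) → map (scale N) w ≡ w
  map-scale-id w = trans (map-cong scale-id w) (map-id w)

isDirectSum : ∀ {N L n₁ n₂} .{{_ : NonZero N}} .{{_ : NonZero L}} → lcm N N ≡ L →
  1 ℕ.≤ n₁ → 1 ℕ.≤ n₂ →
  (C : LinearCode L (n₁ ℕ.+ n₂)) (C₁ : LinearCode N n₁) (C₂ : LinearCode N n₂) →
  (∀ w → w ∈ C ⇔ (∃[ c₁ ] ∃[ c₂ ]
    (c₁ ∈ C₁ × c₂ ∈ C₂ × w ≡ map (scale L) c₁ ++ᵛ map (scale L) c₂))) →
  IsDirectSum C
isDirectSum {n₁ = n₁} {n₂} refl 1≤n₁ 1≤n₂ C C₁ C₂ iff = directSum 1≤n₁ 1≤n₂ C C₁ C₂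
  (Perm.id , λ w → subst (λ v → w ∈ C ⇔ v ∈ (C₁ ⊕ C₂)) (sym (tabulate∘lookup w)) (iff w))

lcm[n,n]≡n : ∀ n → lcm n n ≡ n
lcm[n,n]≡n n = ∣-antisym (lcm-least ∣-refl ∣-refl) (m∣lcm[m,n] n n)

module Even (N : ℕ) .{{_ : NonZero N}} (2∣N : 2 ∣ N) where

  M₂ : ℤ
  M₂ = + (N / 2)

  N≡M₂*2 : + N ≡ M₂ ℤ.* + 2
  N≡M₂*2 = trans (cong +_ (sym (m/n*n≡m 2∣N))) (ℤ.pos-* (N / 2) 2)

  infix 4 _≋_
  infixr 5 _⟨_⟩∷_

  data _≋_ : Point n → Point n → Set where
    []     : [] ≋ []
    _⟨_⟩∷_ : ∀ {i j} {v w : Point n} q → i ≡ j ℤ.+ q ℤ.* (M₂ ℤ.* + 2) → v ≋ w → i ∷ v ≋ j ∷ w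

  π-cong : ∀ (v w : Point n) → v ≋ w → π {N} v ≡ π w
  π-cong []      []      []                  = refl
  π-cong (i ∷ v) (j ∷ w) (q ⟨ eq ⟩∷ v≋w) = cong₂ _∷_
    (residue-cong i j q (trans eq (cong (λ n → j ℤ.+ q ℤ.* n) (sym N≡M₂*2)))) (π-cong v w v≋w)

  point : ℤ → ℤ → ℤ → Point 5
  point κ₁ κ₂ s = M₂ ℤ.* (κ₁ ℤ.+ κ₂) ∷ M₂ ℤ.* κ₂ ∷ M₂ ℤ.* κ₁ ∷ s ∷ ℤ.- s ∷ []

  ParityWord : ℤ → ℤ → Word N 5 → Set
  ParityWord p₁ p₂ w = ∃[ κ₁ ] ∃[ κ₂ ] ∃[ s ] ∃[ q ]
    (κ₁ ℤ.* p₁ ℤ.+ κ₂ ℤ.* p₂ ≡ s ℤ.+ q ℤ.* + 2) × w ≡ π (point κ₁ κ₂ s)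

  parityWord-mod-2 : ∀ {r₁ r₂ p₁ p₂} c₁ c₂ → p₁ ≡ r₁ ℤ.+ c₁ ℤ.* + 2 → p₂ ≡ r₂ ℤ.+ c₂ ℤ.* + 2 →
    ∀ w → ParityWord p₁ p₂ w ⇔ ParityWord r₁ r₂ w
  parityWord-mod-2 {r₁} {r₂} c₁ c₂ refl refl w = mk⇔
    (λ (κ₁ , κ₂ , s , q , eq , eq′) → κ₁ , κ₂ , s , q ℤ.- κ₁ ℤ.* c₁ ℤ.- κ₂ ℤ.* c₂ ,
      trans (ring₁ κ₁ κ₂ r₁ r₂ c₁ c₂) (trans (cong (λ x → x ℤ.- (κ₁ ℤ.* c₁ ℤ.+ κ₂ ℤ.* c₂) ℤ.* + 2) eq)
        (ring₂ κ₁ κ₂ c₁ c₂ s q)) , eq′)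
    (λ (κ₁ , κ₂ , s , q , eq , eq′) → κ₁ , κ₂ , s , q ℤ.+ κ₁ ℤ.* c₁ ℤ.+ κ₂ ℤ.* c₂ ,
      trans (ring₃ κ₁ κ₂ r₁ r₂ c₁ c₂) (trans (cong (λ x → x ℤ.+ (κ₁ ℤ.* c₁ ℤ.+ κ₂ ℤ.* c₂) ℤ.* + 2) eq)
        (ring₄ κ₁ κ₂ c₁ c₂ s q)) , eq′)
    where
    ring₁ : ∀ κ₁ κ₂ r₁ r₂ c₁ c₂ → κ₁ ℤ.* r₁ ℤ.+ κ₂ ℤ.* r₂ ≡
      κ₁ ℤ.* (r₁ ℤ.+ c₁ ℤ.* + 2) ℤ.+ κ₂ ℤ.* (r₂ ℤ.+ c₂ ℤ.* + 2) ℤ.- (κ₁ ℤ.* c₁ ℤ.+ κ₂ ℤ.* c₂) ℤ.* + 2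
    ring₁ = solve-∀
    ring₂ : ∀ κ₁ κ₂ c₁ c₂ s q → s ℤ.+ q ℤ.* + 2 ℤ.- (κ₁ ℤ.* c₁ ℤ.+ κ₂ ℤ.* c₂) ℤ.* + 2 ≡
      s ℤ.+ (q ℤ.- κ₁ ℤ.* c₁ ℤ.- κ₂ ℤ.* c₂) ℤ.* + 2
    ring₂ = solve-∀
    ring₃ : ∀ κ₁ κ₂ r₁ r₂ c₁ c₂ → κ₁ ℤ.* (r₁ ℤ.+ c₁ ℤ.* + 2) ℤ.+ κ₂ ℤ.* (r₂ ℤ.+ c₂ ℤ.* + 2) ≡
      κ₁ ℤ.* r₁ ℤ.+ κ₂ ℤ.* r₂ ℤ.+ (κ₁ ℤ.* c₁ ℤ.+ κ₂ ℤ.* c₂) ℤ.* + 2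
    ring₃ = solve-∀
    ring₄ : ∀ κ₁ κ₂ c₁ c₂ s q → s ℤ.+ q ℤ.* + 2 ℤ.+ (κ₁ ℤ.* c₁ ℤ.+ κ₂ ℤ.* c₂) ℤ.* + 2 ≡
      s ℤ.+ (q ℤ.+ κ₁ ℤ.* c₁ ℤ.+ κ₂ ℤ.* c₂) ℤ.* + 2
    ring₄ = solve-∀

  -- If u b₁ + v b₂ ≡ 1 mod M₂ and κ₁ b₁ + κ₂ b₂ = s + 2q, then the combination
  -- κ - 2q (u , v) of the rows has the same first three coordinates and fourth coordinate s.

  codeOf⇔ : ∀ b₁ b₂ → gcd (gcd (toℕ b₁) (toℕ b₂)) (N / 2) ≡ 1 →
    ∀ w → w ∈ codeOf N b₁ b₂ ⇔ ParityWord (+ toℕ b₁) (+ toℕ b₂) w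
  codeOf⇔ b₁ b₂ gcd≡1 w = mk⇔ to (from (bézout₃ (toℕ b₁) (toℕ b₂) (N / 2) gcd≡1))
    where
    β₁ = + toℕ b₁
    β₂ = + toℕ b₂
    rows : Vec (Point 5) 2
    rows = (M₂ ∷ 0ℤ ∷ M₂ ∷ β₁ ∷ ℤ.- β₁ ∷ []) ∷ (M₂ ∷ M₂ ∷ 0ℤ ∷ β₂ ∷ ℤ.- β₂ ∷ []) ∷ []
    to : w ∈ codeOf N b₁ b₂ → ParityWord β₁ β₂ w
    to w∈C with Equivalence.to (span⇔combination rows w) w∈C
    ... | k₁ ∷ k₂ ∷ [] , refl = k₁ , k₂ , k₁ ℤ.* β₁ ℤ.+ k₂ ℤ.* β₂ , 0ℤ , sym (ℤ.+-identityʳ _) ,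
      cong π (cong₂ _∷_ (r₁ k₁ k₂ M₂) (cong₂ _∷_ (r₂ k₁ k₂ M₂) (cong₂ _∷_ (r₃ k₁ k₂ M₂)
        (cong₂ _∷_ (r₄ k₁ k₂ β₁ β₂) (cong₂ _∷_ (r₅ k₁ k₂ β₁ β₂) refl)))))
      where
      r₁ : ∀ k₁ k₂ m → k₁ ℤ.* m ℤ.+ (k₂ ℤ.* m ℤ.+ 0ℤ) ≡ m ℤ.* (k₁ ℤ.+ k₂)
      r₁ = solve-∀
      r₂ : ∀ k₁ k₂ m → k₁ ℤ.* 0ℤ ℤ.+ (k₂ ℤ.* m ℤ.+ 0ℤ) ≡ m ℤ.* k₂
      r₂ = solve-∀
      r₃ : ∀ k₁ k₂ m → k₁ ℤ.* m ℤ.+ (k₂ ℤ.* 0ℤ ℤ.+ 0ℤ) ≡ m ℤ.* k₁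
      r₃ = solve-∀
      r₄ : ∀ k₁ k₂ b c → k₁ ℤ.* b ℤ.+ (k₂ ℤ.* c ℤ.+ 0ℤ) ≡ k₁ ℤ.* b ℤ.+ k₂ ℤ.* c
      r₄ = solve-∀
      r₅ : ∀ k₁ k₂ b c → k₁ ℤ.* ℤ.- b ℤ.+ (k₂ ℤ.* ℤ.- c ℤ.+ 0ℤ) ≡ ℤ.- (k₁ ℤ.* b ℤ.+ k₂ ℤ.* c)
      r₅ = solve-∀
    from : (∃[ u ] ∃[ v ] ∃[ t ] u ℤ.* β₁ ℤ.+ v ℤ.* β₂ ≡ 1ℤ ℤ.+ t ℤ.* M₂) →
      ParityWord β₁ β₂ w → w ∈ codeOf N b₁ b₂
    from (u , v , t , unit) (κ₁ , κ₂ , s , q , eq , refl) = Equivalence.from (span⇔combination rows w)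
      (k₁ ∷ k₂ ∷ [] ,
        π-cong (point κ₁ κ₂ s) (combination (k₁ ∷ k₂ ∷ []) rows)
          (q ℤ.* (u ℤ.+ v) ⟨ r₁ κ₁ κ₂ q u v M₂ ⟩∷ q ℤ.* v ⟨ r₂ κ₁ κ₂ q u v M₂ ⟩∷ q ℤ.* u ⟨ r₃ κ₁ κ₂ q u v M₂ ⟩∷
          q ℤ.* t ⟨ s≡ ⟩∷ ℤ.- (q ℤ.* t) ⟨ -s≡ ⟩∷ []))
      where
      k₁ = κ₁ ℤ.- q ℤ.* u ℤ.* + 2
      k₂ = κ₂ ℤ.- q ℤ.* v ℤ.* + 2
      r₁ : ∀ κ₁ κ₂ q u v m → m ℤ.* (κ₁ ℤ.+ κ₂) ≡
        (κ₁ ℤ.- q ℤ.* u ℤ.* + 2) ℤ.* m ℤ.+ ((κ₂ ℤ.- q ℤ.* v ℤ.* + 2) ℤ.* m ℤ.+ 0ℤ) ℤ.+ q ℤ.* (u ℤ.+ v) ℤ.* (m ℤ.* + 2)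
      r₁ = solve-∀
      r₂ : ∀ κ₁ κ₂ q u v m → m ℤ.* κ₂ ≡
        (κ₁ ℤ.- q ℤ.* u ℤ.* + 2) ℤ.* 0ℤ ℤ.+ ((κ₂ ℤ.- q ℤ.* v ℤ.* + 2) ℤ.* m ℤ.+ 0ℤ) ℤ.+ q ℤ.* v ℤ.* (m ℤ.* + 2)
      r₂ = solve-∀
      r₃ : ∀ κ₁ κ₂ q u v m → m ℤ.* κ₁ ≡
        (κ₁ ℤ.- q ℤ.* u ℤ.* + 2) ℤ.* m ℤ.+ ((κ₂ ℤ.- q ℤ.* v ℤ.* + 2) ℤ.* 0ℤ ℤ.+ 0ℤ) ℤ.+ q ℤ.* u ℤ.* (m ℤ.* + 2)
      r₃ = solve-∀
      s≡ : s ≡ k₁ ℤ.* β₁ ℤ.+ (k₂ ℤ.* β₂ ℤ.+ 0ℤ) ℤ.+ q ℤ.* t ℤ.* (M₂ ℤ.* + 2)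
      s≡ = begin
        s ≡⟨ r s q t M₂ ⟩
        s ℤ.+ q ℤ.* + 2 ℤ.- q ℤ.* + 2 ℤ.* (1ℤ ℤ.+ t ℤ.* M₂) ℤ.+ q ℤ.* t ℤ.* (M₂ ℤ.* + 2)
          ≡⟨ cong₂ (λ x y → x ℤ.- q ℤ.* + 2 ℤ.* y ℤ.+ q ℤ.* t ℤ.* (M₂ ℤ.* + 2)) eq unit ⟨
        κ₁ ℤ.* β₁ ℤ.+ κ₂ ℤ.* β₂ ℤ.- q ℤ.* + 2 ℤ.* (u ℤ.* β₁ ℤ.+ v ℤ.* β₂) ℤ.+ q ℤ.* t ℤ.* (M₂ ℤ.* + 2)
          ≡⟨ r′ κ₁ κ₂ q u v t M₂ β₁ β₂ ⟩
        k₁ ℤ.* β₁ ℤ.+ (k₂ ℤ.* β₂ ℤ.+ 0ℤ) ℤ.+ q ℤ.* t ℤ.* (M₂ ℤ.* + 2) ∎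
        where
        open ≡-Reasoning
        r : ∀ s q t m → s ≡ s ℤ.+ q ℤ.* + 2 ℤ.- q ℤ.* + 2 ℤ.* (1ℤ ℤ.+ t ℤ.* m) ℤ.+ q ℤ.* t ℤ.* (m ℤ.* + 2)
        r = solve-∀
        r′ : ∀ κ₁ κ₂ q u v t m b c →
          κ₁ ℤ.* b ℤ.+ κ₂ ℤ.* c ℤ.- q ℤ.* + 2 ℤ.* (u ℤ.* b ℤ.+ v ℤ.* c) ℤ.+ q ℤ.* t ℤ.* (m ℤ.* + 2) ≡
          (κ₁ ℤ.- q ℤ.* u ℤ.* + 2) ℤ.* b ℤ.+ ((κ₂ ℤ.- q ℤ.* v ℤ.* + 2) ℤ.* c ℤ.+ 0ℤ) ℤ.+ q ℤ.* t ℤ.* (m ℤ.* + 2)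
        r′ = solve-∀
      -s≡ : ℤ.- s ≡ k₁ ℤ.* ℤ.- β₁ ℤ.+ (k₂ ℤ.* ℤ.- β₂ ℤ.+ 0ℤ) ℤ.+ ℤ.- (q ℤ.* t) ℤ.* (M₂ ℤ.* + 2)
      -s≡ = trans (cong ℤ.-_ s≡) (r k₁ k₂ q t M₂ β₁ β₂)
        where
        r : ∀ k₁ k₂ q t m b c → ℤ.- (k₁ ℤ.* b ℤ.+ (k₂ ℤ.* c ℤ.+ 0ℤ) ℤ.+ q ℤ.* t ℤ.* (m ℤ.* + 2)) ≡
          k₁ ℤ.* ℤ.- b ℤ.+ (k₂ ℤ.* ℤ.- c ℤ.+ 0ℤ) ℤ.+ ℤ.- (q ℤ.* t) ℤ.* (m ℤ.* + 2)
        r = solve-∀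

  codeG⇔ : ∀ w → w ∈ codeG N ⇔ ParityWord 1ℤ 0ℤ w
  codeG⇔ w = mk⇔ to from
    where
    rows : Vec (Point 5) 2
    rows = (M₂ ∷ M₂ ∷ 0ℤ ∷ 0ℤ ∷ 0ℤ ∷ []) ∷ (M₂ ∷ 0ℤ ∷ M₂ ∷ 1ℤ ∷ + N ℤ.- 1ℤ ∷ []) ∷ []
    r₁ : ∀ a κ q m → m ℤ.* (κ ℤ.+ a) ≡
      a ℤ.* m ℤ.+ ((κ ℤ.- q ℤ.* + 2) ℤ.* m ℤ.+ 0ℤ) ℤ.+ q ℤ.* (m ℤ.* + 2)
    r₁ = solve-∀
    r₂ : ∀ a s m → m ℤ.* a ≡ a ℤ.* m ℤ.+ (s ℤ.* 0ℤ ℤ.+ 0ℤ) ℤ.+ 0ℤ ℤ.* (m ℤ.* + 2)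
    r₂ = solve-∀
    r₃ : ∀ a κ q m → m ℤ.* κ ≡
      a ℤ.* 0ℤ ℤ.+ ((κ ℤ.- q ℤ.* + 2) ℤ.* m ℤ.+ 0ℤ) ℤ.+ q ℤ.* (m ℤ.* + 2)
    r₃ = solve-∀
    r₄ : ∀ a s m → s ≡ a ℤ.* 0ℤ ℤ.+ (s ℤ.* 1ℤ ℤ.+ 0ℤ) ℤ.+ 0ℤ ℤ.* (m ℤ.* + 2)
    r₄ = solve-∀
    r₅ : ∀ a s m → ℤ.- s ≡ a ℤ.* 0ℤ ℤ.+ (s ℤ.* (m ℤ.* + 2 ℤ.- 1ℤ) ℤ.+ 0ℤ) ℤ.+ ℤ.- s ℤ.* (m ℤ.* + 2)
    r₅ = solve-∀
    solve-κ : ∀ κ a s q → κ ℤ.* 1ℤ ℤ.+ a ℤ.* 0ℤ ≡ s ℤ.+ q ℤ.* + 2 → s ≡ κ ℤ.- q ℤ.* + 2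
    solve-κ κ a s q eq = trans (r s q) (trans (cong (ℤ._- q ℤ.* + 2) (sym eq)) (r′ κ a q))
      where
      r : ∀ s q → s ≡ s ℤ.+ q ℤ.* + 2 ℤ.- q ℤ.* + 2
      r = solve-∀
      r′ : ∀ κ a q → κ ℤ.* 1ℤ ℤ.+ a ℤ.* 0ℤ ℤ.- q ℤ.* + 2 ≡ κ ℤ.- q ℤ.* + 2
      r′ = solve-∀
    π-point : ∀ κ a s q → s ≡ κ ℤ.- q ℤ.* + 2 →
      π {N} (point κ a s) ≡ π (combination (a ∷ s ∷ []) rows)
    π-point κ a s q refl =
      π-cong (point κ a s) (combination (a ∷ s ∷ []) rows)
        (q ⟨ r₁ a κ q M₂ ⟩∷ 0ℤ ⟨ r₂ a s M₂ ⟩∷ q ⟨ r₃ a κ q M₂ ⟩∷ 0ℤ ⟨ r₄ a s M₂ ⟩∷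
      ℤ.- s ⟨ trans (r₅ a s M₂)
        (cong (λ n → a ℤ.* 0ℤ ℤ.+ (s ℤ.* (n ℤ.- 1ℤ) ℤ.+ 0ℤ) ℤ.+ ℤ.- s ℤ.* (M₂ ℤ.* + 2)) (sym N≡M₂*2)) ⟩∷ [])
    to : w ∈ codeG N → ParityWord 1ℤ 0ℤ w
    to w∈C with Equivalence.to (span⇔combination rows w) w∈C
    ... | a ∷ s ∷ [] , refl = s , a , s , 0ℤ , r s a , sym (π-point s a s 0ℤ (r′ s))
      where
      r : ∀ s a → s ℤ.* 1ℤ ℤ.+ a ℤ.* 0ℤ ≡ s ℤ.+ 0ℤ ℤ.* + 2
      r = solve-∀
      r′ : ∀ s → s ≡ s ℤ.- 0ℤ ℤ.* + 2
      r′ = solve-∀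
    from : ParityWord 1ℤ 0ℤ w → w ∈ codeG N
    from (κ , a , s , q , eq , refl) = Equivalence.from (span⇔combination rows w)
      (a ∷ s ∷ [] , π-point κ a s q (solve-κ κ a s q eq))

  trivially : ∀ i → i ≡ i ℤ.+ 0ℤ ℤ.* (M₂ ℤ.* + 2)
  trivially i = sym (ℤ.+-identityʳ i)

  transpose₁₂ : ∀ {p₁ p₂} w → ParityWord p₁ p₂ w → ParityWord p₂ p₁ (permute (transpose 1F 2F) w)
  transpose₁₂ {p₁} {p₂} _ (κ₁ , κ₂ , s , q , eq , refl) =
    κ₂ , κ₁ , s , q , trans (ℤ.+-comm (κ₂ ℤ.* p₂) (κ₁ ℤ.* p₁)) eq ,
    cong (λ x → residue (M₂ ℤ.* x) ∷ π (M₂ ℤ.* κ₁ ∷ M₂ ℤ.* κ₂ ∷ s ∷ ℤ.- s ∷ [])) (ℤ.+-comm κ₁ κ₂)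

  transpose₀₂ : ∀ {p₁ p₂} w → ParityWord p₁ p₂ w →
    ParityWord p₁ (p₁ ℤ.- p₂) (permute (transpose 0F 2F) w)
  transpose₀₂ {p₁} {p₂} _ (κ₁ , κ₂ , s , q , eq , refl) =
    κ₁ ℤ.+ κ₂ , ℤ.- κ₂ , s , q , trans (ring κ₁ κ₂ p₁ p₂) eq ,
    π-cong (M₂ ℤ.* κ₁ ∷ M₂ ℤ.* κ₂ ∷ M₂ ℤ.* (κ₁ ℤ.+ κ₂) ∷ s ∷ ℤ.- s ∷ []) (point (κ₁ ℤ.+ κ₂) (ℤ.- κ₂) s)
      (0ℤ ⟨ ring₀ κ₁ κ₂ M₂ ⟩∷ κ₂ ⟨ ring₁ κ₂ M₂ ⟩∷ 0ℤ ⟨ trivially (M₂ ℤ.* (κ₁ ℤ.+ κ₂)) ⟩∷ 0ℤ ⟨ trivially s ⟩∷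
      0ℤ ⟨ trivially (ℤ.- s) ⟩∷ [])
    where
    ring : ∀ κ₁ κ₂ p₁ p₂ → (κ₁ ℤ.+ κ₂) ℤ.* p₁ ℤ.+ ℤ.- κ₂ ℤ.* (p₁ ℤ.- p₂) ≡ κ₁ ℤ.* p₁ ℤ.+ κ₂ ℤ.* p₂
    ring = solve-∀
    ring₀ : ∀ κ₁ κ₂ m → m ℤ.* κ₁ ≡ m ℤ.* (κ₁ ℤ.+ κ₂ ℤ.+ ℤ.- κ₂) ℤ.+ 0ℤ ℤ.* (m ℤ.* + 2)
    ring₀ = solve-∀
    ring₁ : ∀ κ₂ m → m ℤ.* κ₂ ≡ m ℤ.* ℤ.- κ₂ ℤ.+ κ₂ ℤ.* (m ℤ.* + 2)
    ring₁ = solve-∀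

  ≅codeG : ∀ (σ : Permutation′ 5) {p₁ p₂} (C : LinearCode N 5) →
    (∀ w → w ∈ C ⇔ ParityWord p₁ p₂ w) →
    (∀ w → permute σ (permute σ w) ≡ w) →
    (∀ w → ParityWord p₁ p₂ w → ParityWord 1ℤ 0ℤ (permute σ w)) →
    (∀ w → ParityWord 1ℤ 0ℤ w → ParityWord p₁ p₂ (permute σ w)) → C ≅ codeG N
  ≅codeG σ C C⇔ invol to from = involution-≅ σ {C} {codeG N} invol
    (λ w → Equivalence.from (codeG⇔ (permute σ w)) ∘ to w ∘ Equivalence.to (C⇔ w))
    (λ w → Equivalence.from (C⇔ (permute σ w)) ∘ from w ∘ Equivalence.to (codeG⇔ w))

  even-isDirectSum : (C : LinearCode N 5) → (∀ w → w ∈ C ⇔ ParityWord 0ℤ 0ℤ w) → IsDirectSum C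
  even-isDirectSum C C⇔ = isDirectSum (lcm[n,n]≡n N) (s≤s z≤n) (s≤s z≤n) C
    (generatedBy (map π rows₁)) (generatedBy (map π rows₂)) (λ w → mk⇔ (to w) (from w))
    where
    rows₁ : Vec (Point 3) 2
    rows₁ = (M₂ ∷ 0ℤ ∷ M₂ ∷ []) ∷ (M₂ ∷ M₂ ∷ 0ℤ ∷ []) ∷ []
    rows₂ : Vec (Point 2) 1
    rows₂ = (+ 2 ∷ ℤ.- + 2 ∷ []) ∷ []
    comb₁ : ∀ κ₁ κ₂ → combination (κ₁ ∷ κ₂ ∷ []) rows₁ ≡ M₂ ℤ.* (κ₁ ℤ.+ κ₂) ∷ M₂ ℤ.* κ₂ ∷ M₂ ℤ.* κ₁ ∷ []
    comb₁ κ₁ κ₂ = cong₂ _∷_ (r₁ κ₁ κ₂ M₂) (cong₂ _∷_ (r₂ κ₁ κ₂ M₂) (cong (_∷ []) (r₃ κ₁ κ₂ M₂)))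
      where
      r₁ : ∀ κ₁ κ₂ m → κ₁ ℤ.* m ℤ.+ (κ₂ ℤ.* m ℤ.+ 0ℤ) ≡ m ℤ.* (κ₁ ℤ.+ κ₂)
      r₁ = solve-∀
      r₂ : ∀ κ₁ κ₂ m → κ₁ ℤ.* 0ℤ ℤ.+ (κ₂ ℤ.* m ℤ.+ 0ℤ) ≡ m ℤ.* κ₂
      r₂ = solve-∀
      r₃ : ∀ κ₁ κ₂ m → κ₁ ℤ.* m ℤ.+ (κ₂ ℤ.* 0ℤ ℤ.+ 0ℤ) ≡ m ℤ.* κ₁
      r₃ = solve-∀
    comb₂ : ∀ s → combination (s ∷ []) rows₂ ≡ s ℤ.* + 2 ∷ ℤ.- (s ℤ.* + 2) ∷ []
    comb₂ s = cong₂ _∷_ (r₁ s) (cong (_∷ []) (r₂ s))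
      where
      r₁ : ∀ s → s ℤ.* + 2 ℤ.+ 0ℤ ≡ s ℤ.* + 2
      r₁ = solve-∀
      r₂ : ∀ s → s ℤ.* ℤ.- + 2 ℤ.+ 0ℤ ≡ ℤ.- (s ℤ.* + 2)
      r₂ = solve-∀
    Split : Word N 5 → Set
    Split w = ∃[ c₁ ] ∃[ c₂ ]
      (c₁ ∈ generatedBy (map π rows₁) × c₂ ∈ generatedBy (map π rows₂) × w ≡ map (scale N) c₁ ++ᵛ map (scale N) c₂)
    to : ∀ w → w ∈ C → Split w
    to w w∈C with κ₁ , κ₂ , s , q , eq , w≡ ← Equivalence.to (C⇔ w) w∈C =
      π (M₂ ℤ.* (κ₁ ℤ.+ κ₂) ∷ M₂ ℤ.* κ₂ ∷ M₂ ℤ.* κ₁ ∷ []) , π (s ∷ ℤ.- s ∷ []) ,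
      Equivalence.from (span⇔combination rows₁ _) (κ₁ ∷ κ₂ ∷ [] , cong π (sym (comb₁ κ₁ κ₂))) ,
      Equivalence.from (span⇔combination rows₂ _) (ℤ.- q ∷ [] ,
        cong π (sym (trans (comb₂ (ℤ.- q)) (cong (λ x → x ∷ ℤ.- x ∷ []) (sym s≡))))) ,
      trans w≡ (sym (cong₂ _++ᵛ_ (map-scale-id (π (M₂ ℤ.* (κ₁ ℤ.+ κ₂) ∷ M₂ ℤ.* κ₂ ∷ M₂ ℤ.* κ₁ ∷ [])))
        (map-scale-id (π (s ∷ ℤ.- s ∷ [])))))
      where
      r : ∀ κ₁ κ₂ s q → s ≡ s ℤ.+ q ℤ.* + 2 ℤ.- (κ₁ ℤ.* 0ℤ ℤ.+ κ₂ ℤ.* 0ℤ) ℤ.+ ℤ.- q ℤ.* + 2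
      r = solve-∀
      s≡ : s ≡ ℤ.- q ℤ.* + 2
      s≡ = trans (r κ₁ κ₂ s q) (trans (cong (ℤ._+ ℤ.- q ℤ.* + 2) (ℤ.i≡j⇒i-j≡0 (sym eq))) (ℤ.+-identityˡ _))
    from : ∀ w → Split w → w ∈ C
    from w (c₁ , c₂ , p₁ , p₂ , refl)
      with Equivalence.to (span⇔combination rows₁ c₁) p₁ | Equivalence.to (span⇔combination rows₂ c₂) p₂
    ... | κ₁ ∷ κ₂ ∷ [] , refl | q ∷ [] , refl =
      Equivalence.from (C⇔ _) (κ₁ , κ₂ , q ℤ.* + 2 , ℤ.- q , r κ₁ κ₂ q ,
        trans (cong₂ _++ᵛ_ (map-scale-id c₁) (map-scale-id c₂))
          (cong₂ _++ᵛ_ (cong π (comb₁ κ₁ κ₂)) (cong π (comb₂ q))))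
      where
      r : ∀ κ₁ κ₂ q → κ₁ ℤ.* 0ℤ ℤ.+ κ₂ ℤ.* 0ℤ ≡ q ℤ.* + 2 ℤ.+ ℤ.- q ℤ.* + 2
      r = solve-∀

  classification : ∀ b₁ b₂ → gcd (gcd (toℕ b₁) (toℕ b₂)) (N / 2) ≡ 1 →
    IsDirectSum (codeOf N b₁ b₂) ⊎ codeOf N b₁ b₂ ≅ codeG N
  classification b₁ b₂ gcd≡1 = cases (parity (toℕ b₁)) (parity (toℕ b₂))
    where
    C = codeOf N b₁ b₂
    involutive₁₂ : ∀ (w : Word N 5) → permute (transpose 1F 2F) (permute (transpose 1F 2F) w) ≡ w
    involutive₁₂ (_ ∷ _ ∷ _ ∷ _ ∷ _ ∷ []) = refl
    involutive₀₂ : ∀ (w : Word N 5) → permute (transpose 0F 2F) (permute (transpose 0F 2F) w) ≡ w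
    involutive₀₂ (_ ∷ _ ∷ _ ∷ _ ∷ _ ∷ []) = refl
    permute-id : ∀ (w : Word N 5) → permute Perm.id w ≡ w
    permute-id = tabulate∘lookup
    cases : (∃[ r ] ∃[ c ] (r ≡ 0ℤ ⊎ r ≡ 1ℤ) × + toℕ b₁ ≡ r ℤ.+ c ℤ.* + 2) →
      (∃[ r ] ∃[ c ] (r ≡ 0ℤ ⊎ r ≡ 1ℤ) × + toℕ b₂ ≡ r ℤ.+ c ℤ.* + 2) →
      IsDirectSum C ⊎ C ≅ codeG N
    cases (r₁ , c₁ , r₁≡ , eq₁) (r₂ , c₂ , r₂≡ , eq₂) = byParity r₁≡ r₂≡
      where
      C⇔ : ∀ w → w ∈ C ⇔ ParityWord r₁ r₂ w
      C⇔ w = parityWord-mod-2 c₁ c₂ eq₁ eq₂ w ⇔-∘ codeOf⇔ b₁ b₂ gcd≡1 w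
      byParity : r₁ ≡ 0ℤ ⊎ r₁ ≡ 1ℤ → r₂ ≡ 0ℤ ⊎ r₂ ≡ 1ℤ → IsDirectSum C ⊎ C ≅ codeG N
      byParity (inj₁ refl) (inj₁ refl) = inj₁ (even-isDirectSum C C⇔)
      byParity (inj₂ refl) (inj₁ refl) = inj₂ (≅codeG Perm.id C C⇔
        (λ w → trans (permute-id _) (permute-id w))
        (λ w → subst (ParityWord _ _) (sym (permute-id w)))
        (λ w → subst (ParityWord _ _) (sym (permute-id w))))
      byParity (inj₁ refl) (inj₂ refl) = inj₂ (≅codeG (transpose 1F 2F) C C⇔ involutive₁₂
        transpose₁₂ transpose₁₂)
      byParity (inj₂ refl) (inj₂ refl) = inj₂ (≅codeG (transpose 0F 2F) C C⇔ involutive₀₂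
        transpose₀₂ transpose₀₂)

-- Power series and counting

difference : PowerSeries → PowerSeries
difference f zero    = f zero
difference f (suc n) = f (suc n) ℤ.- f n

⊛-cong : ∀ {f f′ g g′} → (∀ k → f k ≡ f′ k) → (∀ k → g k ≡ g′ k) → ∀ n → (f ⊛ g) n ≡ (f′ ⊛ g′) n
⊛-cong f≗ g≗ n = Σℤ.sum-cong-≗ {n = suc n} (λ i → cong₂ ℤ._*_ (f≗ (toℕ i)) (g≗ (n ∸ toℕ i)))

0⊛ : ∀ f g n → (∀ k → f k ≡ 0ℤ) → (f ⊛ g) n ≡ 0ℤ
0⊛ f g zero    f≗0 = cong (λ x → x ℤ.* g 0 ℤ.+ 0ℤ) (f≗0 0)
0⊛ f g (suc n) f≗0 = trans (cong₂ (λ x y → x ℤ.* g (suc n) ℤ.+ y) (f≗0 0) (0⊛ (f ∘ suc) g n (f≗0 ∘ suc))) refl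

1-t-⊛ : ∀ g n → (1-t ⊛ g) n ≡ difference g n
1-t-⊛ g zero    = trans (ℤ.+-identityʳ _) (ℤ.*-identityˡ (g 0))
1-t-⊛ g (suc zero) = ring (g 1) (g 0)
  where
  ring : ∀ x y → 1ℤ ℤ.* x ℤ.+ (-1ℤ ℤ.* y ℤ.+ 0ℤ) ≡ x ℤ.- y
  ring = solve-∀
1-t-⊛ g (suc (suc n)) = trans (cong (λ z → 1ℤ ℤ.* g (suc (suc n)) ℤ.+ (-1ℤ ℤ.* g (suc n) ℤ.+ z))
    (0⊛ (λ _ → 0ℤ) g n (λ _ → refl))) (ring (g (suc (suc n))) (g (suc n)))
  where
  ring : ∀ x y → 1ℤ ℤ.* x ℤ.+ (-1ℤ ℤ.* y ℤ.+ 0ℤ) ≡ x ℤ.- y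
  ring = solve-∀

difference-⊛ : ∀ f g n → (f ⊛ difference g) n ≡ (difference f ⊛ g) n
difference-⊛ f g zero    = refl
difference-⊛ f g (suc n) = trans (cong (ℤ._+_ (f 0 ℤ.* (g (suc n) ℤ.- g n))) (difference-⊛ (f ∘ suc) g n)) (shift n)
  where
  shift : ∀ n → f 0 ℤ.* (g (suc n) ℤ.- g n) ℤ.+ (difference (f ∘ suc) ⊛ g) n ≡ (difference f ⊛ g) (suc n)
  shift zero    = ring (f 0) (f 1) (g 0) (g 1)
    where
    ring : ∀ f₀ f₁ g₀ g₁ → f₀ ℤ.* (g₁ ℤ.- g₀) ℤ.+ (f₁ ℤ.* g₀ ℤ.+ 0ℤ) ≡ f₀ ℤ.* g₁ ℤ.+ ((f₁ ℤ.- f₀) ℤ.* g₀ ℤ.+ 0ℤ)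
    ring = solve-∀
  shift (suc n) = ring (f 0) (f 1) (g (suc n)) (g (suc (suc n))) _
    where
    ring : ∀ f₀ f₁ g₀ g₁ t → f₀ ℤ.* (g₁ ℤ.- g₀) ℤ.+ (f₁ ℤ.* g₀ ℤ.+ t) ≡ f₀ ℤ.* g₁ ℤ.+ ((f₁ ℤ.- f₀) ℤ.* g₀ ℤ.+ t)
    ring = solve-∀

⊛-identityʳ : ∀ f n → (f ⊛ 1-t ^ˢ 0) n ≡ f n
⊛-identityʳ f zero    = trans (ℤ.+-identityʳ _) (ℤ.*-identityʳ (f 0))
⊛-identityʳ f (suc n) = trans (cong₂ ℤ._+_ (ℤ.*-zeroʳ (f 0)) (⊛-identityʳ (f ∘ suc) n)) (ℤ.+-identityˡ _)

-- Multiplication by 1 - t takes differences, so a family F with difference (F (suc d)) = F d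
-- satisfies F d · (1 - t)^d = F 0.
⊛-[1-t]^ : (F : ℕ → PowerSeries) → (∀ d n → difference (F (suc d)) n ≡ F d n) →
  ∀ d n → (F d ⊛ 1-t ^ˢ d) n ≡ F 0 n
⊛-[1-t]^ F step zero    n = ⊛-identityʳ (F 0) n
⊛-[1-t]^ F step (suc d) n = begin
  (F (suc d) ⊛ 1-t ^ˢ suc d) n               ≡⟨ ⊛-cong {f = F (suc d)} (λ _ → refl) (1-t-⊛ (1-t ^ˢ d)) n ⟩
  (F (suc d) ⊛ difference (1-t ^ˢ d)) n      ≡⟨ difference-⊛ (F (suc d)) (1-t ^ˢ d) n ⟩
  (difference (F (suc d)) ⊛ 1-t ^ˢ d) n      ≡⟨ ⊛-cong {g = 1-t ^ˢ d} (step d) (λ _ → refl) n ⟩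
  (F d ⊛ 1-t ^ˢ d) n                         ≡⟨ ⊛-[1-t]^ F step d n ⟩
  F 0 n                                      ∎
  where open ≡-Reasoning

incrementHead : Vec ℕ (suc n) → Vec ℕ (suc n)
incrementHead (x ∷ xs) = suc x ∷ xs

compositions : (n k : ℕ) → List (Vec ℕ n)
compositions zero    zero    = [] ∷ []
compositions zero    (suc k) = []
compositions (suc n) zero    = List.map (0 ∷_) (compositions n zero)
compositions (suc n) (suc k) =
  List.map (0 ∷_) (compositions n (suc k)) ++ List.map incrementHead (compositions (suc n) k)

∈-compositions⁻ : ∀ n k {z} → z ∈ˡ compositions n k → Vec.sum z ≡ k
∈-compositions⁻ zero    zero    {[]} _ = refl
∈-compositions⁻ zero    (suc k) ()
∈-compositions⁻ (suc n) zero    p with _ , q , refl ← ∈-map⁻ (0 ∷_) p = ∈-compositions⁻ n zero q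
∈-compositions⁻ (suc n) (suc k) p with ∈-++⁻ (List.map (0 ∷_) (compositions n (suc k))) p
... | inj₁ q with _ , r , refl ← ∈-map⁻ (0 ∷_) q = ∈-compositions⁻ n (suc k) r
... | inj₂ q with _ ∷ _ , r , refl ← ∈-map⁻ incrementHead q = cong suc (∈-compositions⁻ (suc n) k r)

∈-compositions⁺ : ∀ (z : Vec ℕ n) → z ∈ˡ compositions n (Vec.sum z)
∈-compositions⁺ []          = here refl
∈-compositions⁺ (zero ∷ z)  = 0∷ (Vec.sum z) (∈-compositions⁺ z)
  where
  0∷ : ∀ k → z ∈ˡ compositions _ k → (0 ∷ z) ∈ˡ compositions _ k
  0∷ zero    p = ∈-map⁺ (0 ∷_) p
  0∷ (suc k) p = ∈-++⁺ˡ (∈-map⁺ (0 ∷_) p)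
∈-compositions⁺ (suc x ∷ z) = ∈-++⁺ʳ (List.map (0 ∷_) (compositions _ (suc (x ℕ.+ Vec.sum z))))
  (∈-map⁺ incrementHead (∈-compositions⁺ (x ∷ z)))

compositions-unique : ∀ n k → Unique (compositions n k)
compositions-unique zero    zero    = All.[] AllPairs.∷ AllPairs.[]
compositions-unique zero    (suc k) = AllPairs.[]
compositions-unique (suc n) zero    = Unique.map⁺ (λ { refl → refl }) (compositions-unique n zero)
compositions-unique (suc n) (suc k) = Unique.++⁺
  (Unique.map⁺ (λ { refl → refl }) (compositions-unique n (suc k)))
  (Unique.map⁺ (λ { {_ ∷ _} {_ ∷ _} refl → refl }) (compositions-unique (suc n) k))
  λ { (p , q) → disjoint p q }
  where
  disjoint : ∀ {z} → z ∈ˡ List.map (0 ∷_) (compositions n (suc k)) →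
    ¬ z ∈ˡ List.map incrementHead (compositions (suc n) k)
  disjoint p q with ∈-map⁻ (0 ∷_) p | ∈-map⁻ incrementHead q
  ... | _ , _ , refl | (_ ∷ _) , _ , ()

count : ℕ → ℕ → ℕ
count n k = length (compositions n k)

count-suc-zero : ∀ n → count (suc n) 0 ≡ count n 0
count-suc-zero n = length-map (0 ∷_) (compositions n 0)

count-suc-suc : ∀ n k → count (suc n) (suc k) ≡ count n (suc k) ℕ.+ count (suc n) k
count-suc-suc n k = trans (length-++ (List.map (0 ∷_) (compositions n (suc k))))
  (cong₂ ℕ._+_ (length-map _ (compositions n (suc k))) (length-map _ (compositions (suc n) k)))

-- Σᵢ hᵢ count n (k - i), the coefficient of t^k in (Σᵢ hᵢ tⁱ) / (1 - t)ⁿ.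
ehrhart : List ℕ → ℕ → ℕ → ℕ
ehrhart []       n k       = 0
ehrhart (h ∷ hs) n zero    = h ℕ.* count n 0
ehrhart (h ∷ hs) n (suc k) = h ℕ.* count n (suc k) ℕ.+ ehrhart hs n k

ehrhart-suc-zero : ∀ hs n → ehrhart hs (suc n) 0 ≡ ehrhart hs n 0
ehrhart-suc-zero []       n = refl
ehrhart-suc-zero (h ∷ hs) n = cong (h ℕ.*_) (count-suc-zero n)

ehrhart-suc-suc : ∀ hs n k → ehrhart hs (suc n) (suc k) ≡ ehrhart hs n (suc k) ℕ.+ ehrhart hs (suc n) k
ehrhart-suc-suc []       n k = refl
ehrhart-suc-suc (h ∷ hs) n zero = trans
  (cong₂ (λ x y → h ℕ.* x ℕ.+ y) (count-suc-suc n 0) (ehrhart-suc-zero hs n))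
  (rearr h (count n 1) (count (suc n) 0) (ehrhart hs n 0))
  where
  rearr : ∀ h a b c → h ℕ.* (a ℕ.+ b) ℕ.+ c ≡ h ℕ.* a ℕ.+ c ℕ.+ h ℕ.* b
  rearr = ℕsolve-∀
ehrhart-suc-suc (h ∷ hs) n (suc k) = trans
  (cong₂ (λ x y → h ℕ.* x ℕ.+ y) (count-suc-suc n (suc k)) (ehrhart-suc-suc hs n k))
  (rearr h (count n (suc (suc k))) (count (suc n) (suc k)) (ehrhart hs n (suc k)) (ehrhart hs (suc n) k))
  where
  rearr : ∀ h a b c d → h ℕ.* (a ℕ.+ b) ℕ.+ (c ℕ.+ d) ≡ h ℕ.* a ℕ.+ c ℕ.+ (h ℕ.* b ℕ.+ d)
  rearr = ℕsolve-∀

ehrhart-zero : ∀ hs k → + ehrhart hs 0 k ≡ fromCoefficients (List.map +_ hs) k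
ehrhart-zero []       k       = refl
ehrhart-zero (h ∷ hs) zero    = cong +_ (ℕ.*-identityʳ h)
ehrhart-zero (h ∷ hs) (suc k) =
  trans (cong (λ x → + (x ℕ.+ ehrhart hs 0 k)) (ℕ.*-zeroʳ h)) (ehrhart-zero hs k)

ehrhart-⊛-[1-t]^ : ∀ hs n j →
  ((λ k → + ehrhart hs n k) ⊛ 1-t ^ˢ n) j ≡ fromCoefficients (List.map +_ hs) j
ehrhart-⊛-[1-t]^ hs n j =
  trans (⊛-[1-t]^ (λ d k → + ehrhart hs d k) step n j) (ehrhart-zero hs j)
  where
  step : ∀ d k → difference (λ k → + ehrhart hs (suc d) k) k ≡ + ehrhart hs d k
  step d zero    = cong +_ (ehrhart-suc-zero hs d)
  step d (suc k) = trans (cong (λ x → + x ℤ.- + ehrhart hs (suc d) k) (ehrhart-suc-suc hs d k))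
    (trans (cong (ℤ._- + ehrhart hs (suc d) k) (ℤ.pos-+ (ehrhart hs d (suc k)) _))
      (cancel (+ ehrhart hs d (suc k)) (+ ehrhart hs (suc d) k)))
    where
    cancel : ∀ a b → a ℤ.+ b ℤ.- b ≡ a
    cancel = solve-∀

-- Convex hulls of translated coordinate simplices

ι : ℤ → ℚ
ι i = i ℚ./ 1

toℚᵘ-ι : ∀ i → toℚᵘ (ι i) ℚᵘ.≃ mkℚᵘ i 0
toℚᵘ-ι i = ℚ.toℚᵘ-fromℚᵘ (mkℚᵘ i 0)

ι-injective : ∀ {i j} → ι i ≡ ι j → i ≡ j
ι-injective {i} {j} eq with ℚᵘ.≃-trans (ℚᵘ.≃-sym (toℚᵘ-ι i)) (ℚᵘ.≃-trans (ℚᵘ.≃-reflexive (cong toℚᵘ eq)) (toℚᵘ-ι j))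
... | *≡* i*1≡j*1 = trans (sym (ℤ.*-identityʳ i)) (trans i*1≡j*1 (ℤ.*-identityʳ j))

ι-+ : ∀ i j → ι (i ℤ.+ j) ≡ ι i ℚ.+ ι j
ι-+ i j = ℚ.toℚᵘ-injective (ℚᵘ.≃-trans (toℚᵘ-ι (i ℤ.+ j)) (ℚᵘ.≃-trans (*≡* (ring i j))
  (ℚᵘ.≃-sym (ℚᵘ.≃-trans (ℚ.toℚᵘ-homo-+ (ι i) (ι j)) (ℚᵘ.+-cong (toℚᵘ-ι i) (toℚᵘ-ι j))))))
  where
  ring : ∀ i j → (i ℤ.+ j) ℤ.* 1ℤ ≡ (i ℤ.* 1ℤ ℤ.+ j ℤ.* 1ℤ) ℤ.* 1ℤ
  ring = solve-∀

ι-sum : ∀ {n} (f : Fin n → ℤ) → ι (Σℤ.sum f) ≡ Σℚ.sum (ι ∘ f)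
ι-sum {zero}  f = refl
ι-sum {suc n} f = trans (ι-+ (f zero) _) (cong (ι (f zero) ℚ.+_) (ι-sum (f ∘ suc)))

0≤ι⁺ : ∀ n → 0ℚ ℚ.≤ ι (+ n)
0≤ι⁺ n = ℚ.nonNegative⁻¹ (ι (+ n)) {{ℚ.normalize-nonNeg n 1}}

0≤ι⁻ : ∀ i → 0ℚ ℚ.≤ ι i → 0ℤ ℤ.≤ i
0≤ι⁻ i 0≤ιi = subst (0ℤ ℤ.≤_) (ℤ.*-identityʳ i)
  (ℚᵘ.drop-*≤* (ℚᵘ.≤-respʳ-≃ (toℚᵘ-ι i) (ℚ.toℚᵘ-mono-≤ 0≤ιi)))

0≤* : ∀ {p q} → 0ℚ ℚ.≤ p → 0ℚ ℚ.≤ q → 0ℚ ℚ.≤ p ℚ.* q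
0≤* {p} {q} 0≤p 0≤q = ℚ.nonNegative⁻¹ (p ℚ.* q)
  {{ℚ.nonNeg*nonNeg⇒nonNeg p {{ℚ.nonNegative 0≤p}} q {{ℚ.nonNegative 0≤q}}}}

reciprocal : ∀ c .{{_ : NonZero c}} → ∃[ u ] 0ℚ ℚ.≤ u × u ℚ.* ι (+ c) ≡ 1ℚ
reciprocal c@(suc c-1) = 1ℤ ℚ./ c , ℚ.nonNegative⁻¹ (1ℤ ℚ./ c) {{ℚ.normalize-nonNeg 1 c}} ,
  ℚ.toℚᵘ-injective (ℚᵘ.≃-trans (ℚ.toℚᵘ-homo-* (1ℤ ℚ./ c) (ι (+ c)))
    (ℚᵘ.≃-trans (ℚᵘ.*-cong (ℚ.toℚᵘ-fromℚᵘ (mkℚᵘ 1ℤ c-1)) (toℚᵘ-ι (+ c))) (*≡* (ring (+ c)))))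
  where
  ring : ∀ c → 1ℤ ℤ.* c ℤ.* 1ℤ ≡ 1ℤ ℤ.* (c ℤ.* 1ℤ)
  ring = solve-∀

axis : ℤ → Fin n → Point n
axis c i = replicate _ 0ℤ [ i ]≔ c

lookup-axis : ∀ c (i j : Fin n) → lookup (axis c i) j ≡ lookup (axis 1ℤ i) j ℤ.* c
lookup-axis {suc n} c zero    zero    = sym (ℤ.*-identityˡ c)
lookup-axis {suc n} c zero    (suc j) = trans (lookup-replicate j 0ℤ) (cong (ℤ._* c) (sym (lookup-replicate j 0ℤ)))
lookup-axis {suc n} c (suc i) zero    = refl
lookup-axis {suc n} c (suc i) (suc j) = lookup-axis c i j

Σℤ-axis : ∀ c (i : Fin n) → Σℤ.sum (lookup (axis c i)) ≡ c
Σℤ-axis {suc n} c zero    = trans (cong (ℤ._+_ c)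
  (trans (Σℤ.sum-cong-≗ {n} (λ j → lookup-replicate j 0ℤ)) (Σℤ.sum-replicate-zero n))) (ℤ.+-identityʳ c)
Σℤ-axis {suc n} c (suc i) = trans (ℤ.+-identityˡ _) (Σℤ-axis c i)

Σℚ-*-axis : ∀ c (t : Fin n → ℚ) j → Σℚ.sum (λ i → t i ℚ.* ι (lookup (axis c i) j)) ≡ ι c ℚ.* t j
Σℚ-*-axis {suc n} c t zero = trans (cong₂ ℚ._+_ (ℚ.*-comm (t zero) (ι c))
  (trans (Σℚ.sum-cong-≗ (λ i → ℚ.*-zeroʳ (t (suc i)))) (Σℚ.sum-replicate-zero n))) (ℚ.+-identityʳ _)
Σℚ-*-axis {suc n} c t (suc j) = trans (cong₂ ℚ._+_
  (trans (cong (λ x → t zero ℚ.* ι x) (lookup-replicate j 0ℤ)) (ℚ.*-zeroʳ (t zero)))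
  (Σℚ-*-axis c (t ∘ suc) j)) (ℚ.+-identityˡ _)

module _ (v : Fin n → Point n) (o : Fin n → ℤ) (c : ℕ)
         (v-axes : ∀ i j → lookup (v i) j ≡ o j ℤ.+ lookup (axis (+ c) i) j) where

  private
    combination-coordinate : ∀ (t : Fin n → ℚ) → Σℚ.sum t ≡ 1ℚ → ∀ j →
      Σℚ.sum (λ i → t i ℚ.* ι (lookup (v i) j)) ≡ ι (o j) ℚ.+ ι (+ c) ℚ.* t j
    combination-coordinate t ∑t≡1 j = begin
      Σℚ.sum (λ i → t i ℚ.* ι (lookup (v i) j))
        ≡⟨ Σℚ.sum-cong-≗ (λ i → trans
             (cong (t i ℚ.*_) (trans (cong ι (v-axes i j)) (ι-+ (o j) (lookup (axis (+ c) i) j))))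
             (ℚ.*-distribˡ-+ (t i) (ι (o j)) (ι (lookup (axis (+ c) i) j)))) ⟩
      Σℚ.sum (λ i → t i ℚ.* ι (o j) ℚ.+ t i ℚ.* ι (lookup (axis (+ c) i) j))
        ≡⟨ Σℚ.∑-distrib-+ (λ i → t i ℚ.* ι (o j)) (λ i → t i ℚ.* ι (lookup (axis (+ c) i) j)) ⟩
      Σℚ.sum (λ i → t i ℚ.* ι (o j)) ℚ.+ Σℚ.sum (λ i → t i ℚ.* ι (lookup (axis (+ c) i) j))
        ≡⟨ cong₂ ℚ._+_ (sym (Σℚ.*-distribʳ-sum (ι (o j)) t)) (Σℚ-*-axis (+ c) t j) ⟩
      Σℚ.sum t ℚ.* ι (o j) ℚ.+ ι (+ c) ℚ.* t j
        ≡⟨ cong (ℚ._+ ι (+ c) ℚ.* t j) (trans (cong (ℚ._* ι (o j)) ∑t≡1) (ℚ.*-identityˡ (ι (o j)))) ⟩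
      ι (o j) ℚ.+ ι (+ c) ℚ.* t j ∎
      where open ≡-Reasoning

  conv⁻ : ∀ x → Conv v x →
    Σ[ y ∈ (Fin n → ℕ) ] Σℤ.sum (λ j → + y j) ≡ + c × (∀ j → lookup x j ≡ o j ℤ.+ + y j)
  conv⁻ x (t , 0≤t , ∑t≡1 , x≡) = (λ j → ℤ.∣ z j ∣) , ι-injective ∑y≡c ,
    λ j → trans (split (lookup x j) (o j)) (cong (ℤ._+_ (o j)) (z≡+∣z∣ j))
    where
    z : Fin n → ℤ
    z j = lookup x j ℤ.- o j
    split : ∀ x o → x ≡ o ℤ.+ (x ℤ.- o)
    split = solve-∀
    ιz≡ct : ∀ j → ι (z j) ≡ ι (+ c) ℚ.* t j
    ιz≡ct j = ℚGroup.∙-cancelˡ (ι (o j)) (ι (z j)) (ι (+ c) ℚ.* t j)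
      (trans (sym (ι-+ (o j) (z j))) (trans (cong ι (sym (split (lookup x j) (o j))))
        (trans (x≡ j) (combination-coordinate t ∑t≡1 j))))
    z≡+∣z∣ : ∀ j → z j ≡ + ℤ.∣ z j ∣
    z≡+∣z∣ j = sym (ℤ.0≤i⇒+∣i∣≡i (0≤ι⁻ (z j) (subst (0ℚ ℚ.≤_) (sym (ιz≡ct j)) (0≤* (0≤ι⁺ c) (0≤t j)))))
    ∑y≡c : ι (Σℤ.sum (λ j → + ℤ.∣ z j ∣)) ≡ ι (+ c)
    ∑y≡c = begin
      ι (Σℤ.sum (λ j → + ℤ.∣ z j ∣))           ≡⟨ ι-sum (λ j → + ℤ.∣ z j ∣) ⟩
      Σℚ.sum (λ j → ι (+ ℤ.∣ z j ∣))           ≡⟨ Σℚ.sum-cong-≗ (λ j → trans (cong ι (sym (z≡+∣z∣ j))) (ιz≡ct j)) ⟩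
      Σℚ.sum (λ j → ι (+ c) ℚ.* t j)           ≡⟨ Σℚ.*-distribˡ-sum (ι (+ c)) t ⟨
      ι (+ c) ℚ.* Σℚ.sum t                     ≡⟨ trans (cong (ι (+ c) ℚ.*_) ∑t≡1) (ℚ.*-identityʳ _) ⟩
      ι (+ c)                                  ∎
      where open ≡-Reasoning

  module _ .{{_ : NonZero c}} where

    private
      weights : ∀ (y : Fin n → ℤ) → Σℤ.sum y ≡ + c → ∀ x → (∀ j → lookup x j ≡ o j ℤ.+ y j) →
        ∀ u → u ℚ.* ι (+ c) ≡ 1ℚ → IsAffineCombination (λ j → u ℚ.* ι (y j)) v x
      weights y ∑y≡c x x≡ u uc≡1 = ∑t≡1 , λ j → begin
        ι (lookup x j)                            ≡⟨ trans (cong ι (x≡ j)) (ι-+ (o j) (y j)) ⟩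
        ι (o j) ℚ.+ ι (y j)                       ≡⟨ cong (ι (o j) ℚ.+_) (cancel (ι (y j))) ⟨
        ι (o j) ℚ.+ ι (+ c) ℚ.* (u ℚ.* ι (y j))   ≡⟨ combination-coordinate (λ j → u ℚ.* ι (y j)) ∑t≡1 j ⟨
        Σℚ.sum (λ i → u ℚ.* ι (y i) ℚ.* ι (lookup (v i) j)) ∎
        where
        open ≡-Reasoning
        cancel : ∀ q → ι (+ c) ℚ.* (u ℚ.* q) ≡ q
        cancel q = trans (sym (ℚ.*-assoc (ι (+ c)) u q))
          (trans (cong (ℚ._* q) (trans (ℚ.*-comm (ι (+ c)) u) uc≡1)) (ℚ.*-identityˡ q))
        ∑t≡1 : Σℚ.sum (λ j → u ℚ.* ι (y j)) ≡ 1ℚ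
        ∑t≡1 = trans (sym (Σℚ.*-distribˡ-sum u (ι ∘ y)))
          (trans (cong (u ℚ.*_) (trans (sym (ι-sum y)) (cong ι ∑y≡c))) uc≡1)

    aff⁺ : ∀ (y : Fin n → ℤ) → Σℤ.sum y ≡ + c → ∀ x → (∀ j → lookup x j ≡ o j ℤ.+ y j) → Aff v x
    aff⁺ y ∑y≡c x x≡ with u , _ , uc≡1 ← reciprocal c = _ , weights y ∑y≡c x x≡ u uc≡1

    conv⁺ : ∀ (y : Fin n → ℕ) → Σℤ.sum (λ j → + y j) ≡ + c → ∀ x →
      (∀ j → lookup x j ≡ o j ℤ.+ + y j) → Conv v x
    conv⁺ y ∑y≡c x x≡ with u , 0≤u , uc≡1 ← reciprocal c =
      _ , (λ j → 0≤* 0≤u (0≤ι⁺ (y j))) , weights (λ j → + y j) ∑y≡c x x≡ u uc≡1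

-- Lattice points of the simplex of a code

lookup-injective : ∀ {u v : Vec A n} → (∀ i → lookup u i ≡ lookup v i) → u ≡ v
lookup-injective {u = u} {v} eq = trans (sym (tabulate∘lookup u)) (trans (tabulate-cong eq) (tabulate∘lookup v))

Σℤ-lookup : ∀ (v : Vec ℕ n) → Σℤ.sum (λ j → + lookup v j) ≡ + Vec.sum v
Σℤ-lookup []      = refl
Σℤ-lookup (x ∷ v) = trans (cong (ℤ._+_ (+ x)) (Σℤ-lookup v)) (sym (ℤ.pos-+ x (Vec.sum v)))

length-cartesianProduct : ∀ {A B : Set} (xs : List A) (ys : List B) →
  length (cartesianProduct xs ys) ≡ length xs ℕ.* length ys
length-cartesianProduct []       ys = refl
length-cartesianProduct (x ∷ xs) ys = trans (length-++ (List.map (x ,_) ys))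
  (cong₂ ℕ._+_ (length-map (x ,_) ys) (length-cartesianProduct xs ys))

AtLevel : List (List A) → ℕ → A → Set
AtLevel []       _       _ = ⊥
AtLevel (W ∷ Ws) zero    a = a ∈ˡ W
AtLevel (W ∷ Ws) (suc i) a = AtLevel Ws i a

gradedPairs : List (List A) → ∀ n → ℕ → List (A × Vec ℕ n)
gradedPairs []       n k       = []
gradedPairs (W ∷ Ws) n zero    = cartesianProduct W (compositions n 0)
gradedPairs (W ∷ Ws) n (suc k) = cartesianProduct W (compositions n (suc k)) ++ gradedPairs Ws n k

∈-gradedPairs⁻ : ∀ (Ws : List (List A)) k {a} {z : Vec ℕ n} → (a , z) ∈ˡ gradedPairs Ws n k →
  ∃[ i ] AtLevel Ws i a × i ℕ.+ Vec.sum z ≡ k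
∈-gradedPairs⁻ (W ∷ Ws) zero p with a∈W , z∈ ← ∈-cartesianProduct⁻ W (compositions _ 0) p =
  0 , a∈W , ∈-compositions⁻ _ 0 z∈
∈-gradedPairs⁻ (W ∷ Ws) (suc k) p with ∈-++⁻ (cartesianProduct W (compositions _ (suc k))) p
... | inj₁ q with a∈W , z∈ ← ∈-cartesianProduct⁻ W (compositions _ (suc k)) q =
  0 , a∈W , ∈-compositions⁻ _ (suc k) z∈
... | inj₂ q with i , a∈ , eq ← ∈-gradedPairs⁻ Ws k q = suc i , a∈ , cong suc eq

∈-gradedPairs⁺ : ∀ (Ws : List (List A)) i {a} (z : Vec ℕ n) → AtLevel Ws i a →
  (a , z) ∈ˡ gradedPairs Ws n (i ℕ.+ Vec.sum z)
∈-gradedPairs⁺ {n = n} (W ∷ Ws) zero {a} z a∈W = level₀ (Vec.sum z) (∈-compositions⁺ z)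
  where
  level₀ : ∀ k → z ∈ˡ compositions n k → (a , z) ∈ˡ gradedPairs (W ∷ Ws) n k
  level₀ zero    z∈ = ∈-cartesianProduct⁺ a∈W z∈
  level₀ (suc k) z∈ = ∈-++⁺ˡ (∈-cartesianProduct⁺ a∈W z∈)
∈-gradedPairs⁺ (W ∷ Ws) (suc i) z a∈ = ∈-++⁺ʳ (cartesianProduct W _) (∈-gradedPairs⁺ Ws i z a∈)

gradedPairs-unique : ∀ (Ws : List (List A)) n k → All Unique Ws →
  (∀ {i j a} → AtLevel Ws i a → AtLevel Ws j a → i ≡ j) → Unique (gradedPairs Ws n k)
gradedPairs-unique []       n k       _                        _   = AllPairs.[]
gradedPairs-unique (W ∷ Ws) n zero    (W-unique All.∷ _)       _   =
  Unique.cartesianProduct⁺ W-unique (compositions-unique n 0)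
gradedPairs-unique (W ∷ Ws) n (suc k) (W-unique All.∷ uniques) level-unique = Unique.++⁺
  (Unique.cartesianProduct⁺ W-unique (compositions-unique n (suc k)))
  (gradedPairs-unique Ws n k uniques (λ p q → ℕ.suc-injective (level-unique p q)))
  λ { {_ , _} (p , q) → disjoint p q }
  where
  disjoint : ∀ {a z} → (a , z) ∈ˡ cartesianProduct W (compositions n (suc k)) →
    ¬ (a , z) ∈ˡ gradedPairs Ws n k
  disjoint p q with a∈W , _ ← ∈-cartesianProduct⁻ W (compositions n (suc k)) p
                  | i , a∈ , _ ← ∈-gradedPairs⁻ Ws k q =
    contradiction (level-unique {0} {suc i} a∈W a∈) λ ()

length-gradedPairs : ∀ (Ws : List (List A)) n k →
  length (gradedPairs Ws n k) ≡ ehrhart (List.map length Ws) n k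
length-gradedPairs []       n k       = refl
length-gradedPairs (W ∷ Ws) n zero    = length-cartesianProduct W (compositions n 0)
length-gradedPairs (W ∷ Ws) n (suc k) = trans (length-++ (cartesianProduct W (compositions n (suc k))))
  (cong₂ ℕ._+_ (length-cartesianProduct W (compositions n (suc k))) (length-gradedPairs Ws n k))

module _ {N d} .{{_ : NonZero N}} (C : LinearCode N (suc d)) (zeroSums : HasZeroSums C) where

  private
    Δ = simplexOf C zeroSums

  offset : ℕ → Fin (suc d) → ℤ
  offset k j = (1ℤ ℤ.- + k) ℤ.* lookup (axis 1ℤ (zero {n = d})) j

  coordinate : ℕ → Word N (suc d) → Vec ℕ (suc d) → Fin (suc d) → ℤ
  coordinate k c z j = + toℕ (lookup c j) ℤ.+ (+ lookup z j ℤ.+ offset k j) ℤ.* + N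

  encode : ℕ → Word N (suc d) × Vec ℕ (suc d) → Point (suc d)
  encode k (c , z) = tabulate (coordinate k c z)

  dilate-axes : ∀ k i j →
    lookup (dilate k Δ i) j ≡ offset k j ℤ.* + N ℤ.+ lookup (axis (+ (k ℕ.* N)) i) j
  dilate-axes k i j = begin
    lookup (dilate k Δ i) j
      ≡⟨ lookup-zipWith _ j (axis (+ N) zero) (axis (+ N) i) ⟩
    lookup (axis (+ N) zero) j ℤ.+ + k ℤ.* (lookup (axis (+ N) i) j ℤ.- lookup (axis (+ N) zero) j)
      ≡⟨ cong₂ (λ o x → o ℤ.+ + k ℤ.* (x ℤ.- o)) (lookup-axis (+ N) zero j) (lookup-axis (+ N) i j) ⟩
    lookup (axis 1ℤ zero) j ℤ.* + N ℤ.+ + k ℤ.* (lookup (axis 1ℤ i) j ℤ.* + N ℤ.- lookup (axis 1ℤ zero) j ℤ.* + N)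
      ≡⟨ ring (lookup (axis 1ℤ (zero {n = d})) j) (lookup (axis 1ℤ i) j) (+ k) (+ N) ⟩
    offset k j ℤ.* + N ℤ.+ lookup (axis 1ℤ i) j ℤ.* (+ k ℤ.* + N)
      ≡⟨ cong (λ x → offset k j ℤ.* + N ℤ.+ lookup (axis 1ℤ i) j ℤ.* x) (ℤ.pos-* k N) ⟨
    offset k j ℤ.* + N ℤ.+ lookup (axis 1ℤ i) j ℤ.* + (k ℕ.* N)
      ≡⟨ cong (ℤ._+_ (offset k j ℤ.* + N)) (lookup-axis (+ (k ℕ.* N)) i j) ⟨
    offset k j ℤ.* + N ℤ.+ lookup (axis (+ (k ℕ.* N)) i) j ∎
    where
    open ≡-Reasoning
    ring : ∀ e₀ eᵢ k n → e₀ ℤ.* n ℤ.+ k ℤ.* (eᵢ ℤ.* n ℤ.- e₀ ℤ.* n) ≡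
      (1ℤ ℤ.- k) ℤ.* e₀ ℤ.* n ℤ.+ eᵢ ℤ.* (k ℤ.* n)
    ring = solve-∀

  π-encode : ∀ k c z → π (encode k (c , z)) ≡ c
  π-encode k c z = lookup-injective λ j → trans (lookup-map j residue (encode k (c , z)))
    (trans (cong residue (lookup∘tabulate (coordinate k c z) j))
      (residue-unique {i = coordinate k c z j} (lookup c j) (+ lookup z j ℤ.+ offset k j) refl))

  coordinate-injective : ∀ k c z z′ j → coordinate k c z j ≡ coordinate k c z′ j → lookup z j ≡ lookup z′ j
  coordinate-injective k c z z′ j eq = ℤ.+-injective (ℤGroup.∙-cancelʳ o a b
    (ℤ.*-cancelʳ-≡ (a ℤ.+ o) (b ℤ.+ o) (+ N)
      (ℤGroup.∙-cancelˡ (+ toℕ (lookup c j)) ((a ℤ.+ o) ℤ.* + N) ((b ℤ.+ o) ℤ.* + N) eq)))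
    where
    o a b : ℤ
    o = offset k j
    a = + lookup z j
    b = + lookup z′ j

  encode-injective : ∀ k {p q} → encode k p ≡ encode k q → p ≡ q
  encode-injective k {c , z} {c′ , z′} eq =
    step (trans (sym (π-encode k c z)) (trans (cong π eq) (π-encode k c′ z′))) eq
    where
    step : ∀ {c′} → c ≡ c′ → encode k (c , z) ≡ encode k (c′ , z′) → (c , z) ≡ (c′ , z′)
    step refl eq = cong (c ,_) (lookup-injective λ j → coordinate-injective k c z z′ j
      (trans (sym (lookup∘tabulate (coordinate k c z) j))
        (trans (cong (λ x → lookup x j) eq) (lookup∘tabulate (coordinate k c z′) j))))

  Σℤ-digits : ∀ (c : Word N (suc d)) (z : Vec ℕ (suc d)) →
    Σℤ.sum (λ j → + (toℕ (lookup c j) ℕ.+ lookup z j ℕ.* N)) ≡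
      + (Vec.sum (Vec.map toℕ c) ℕ.+ Vec.sum z ℕ.* N)
  Σℤ-digits c z = begin
    Σℤ.sum (λ j → + (toℕ (lookup c j) ℕ.+ lookup z j ℕ.* N))
      ≡⟨ Σℤ.sum-cong-≗ (λ j → trans (ℤ.pos-+ (toℕ (lookup c j)) (lookup z j ℕ.* N))
           (cong₂ ℤ._+_ (cong +_ (sym (lookup-map j toℕ c))) (ℤ.pos-* (lookup z j) N))) ⟩
    Σℤ.sum (λ j → + lookup (Vec.map toℕ c) j ℤ.+ + lookup z j ℤ.* + N)
      ≡⟨ Σℤ.∑-distrib-+ (λ j → + lookup (Vec.map toℕ c) j) (λ j → + lookup z j ℤ.* + N) ⟩
    Σℤ.sum (λ j → + lookup (Vec.map toℕ c) j) ℤ.+ Σℤ.sum (λ j → + lookup z j ℤ.* + N)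
      ≡⟨ cong₂ ℤ._+_ (Σℤ-lookup (Vec.map toℕ c)) (trans (sym (Σℤ.*-distribʳ-sum (+ N) (λ j → + lookup z j)))
           (cong (ℤ._* + N) (Σℤ-lookup z))) ⟩
    + Vec.sum (Vec.map toℕ c) ℤ.+ + Vec.sum z ℤ.* + N
      ≡⟨ cong (ℤ._+_ (+ Vec.sum (Vec.map toℕ c))) (ℤ.pos-* (Vec.sum z) N) ⟨
    + Vec.sum (Vec.map toℕ c) ℤ.+ + (Vec.sum z ℕ.* N)
      ≡⟨ ℤ.pos-+ (Vec.sum (Vec.map toℕ c)) (Vec.sum z ℕ.* N) ⟨
    + (Vec.sum (Vec.map toℕ c) ℕ.+ Vec.sum z ℕ.* N) ∎
    where open ≡-Reasoning

  Σℤ-offset : ∀ k → Σℤ.sum (λ j → offset k j ℤ.* + N) ≡ (1ℤ ℤ.- + k) ℤ.* + N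
  Σℤ-offset k = trans (sym (Σℤ.*-distribʳ-sum (+ N) (offset k))) (cong (ℤ._* + N)
    (trans (sym (Σℤ.*-distribˡ-sum (1ℤ ℤ.- + k) (lookup (axis 1ℤ (zero {n = d})))))
      (trans (cong ((1ℤ ℤ.- + k) ℤ.*_) (Σℤ-axis 1ℤ (zero {n = d}))) (ℤ.*-identityʳ (1ℤ ℤ.- + k)))))

  lookup-encode : ∀ k c z j →
    lookup (encode k (c , z)) j ≡ offset k j ℤ.* + N ℤ.+ + (toℕ (lookup c j) ℕ.+ lookup z j ℕ.* N)
  lookup-encode k c z j = trans (lookup∘tabulate (coordinate k c z) j)
    (trans (ring (+ toℕ (lookup c j)) (+ lookup z j) (offset k j) (+ N))
      (cong (ℤ._+_ (offset k j ℤ.* + N)) (sym (trans (ℤ.pos-+ (toℕ (lookup c j)) (lookup z j ℕ.* N))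
        (cong (ℤ._+_ (+ toℕ (lookup c j))) (ℤ.pos-* (lookup z j) N))))))
    where
    ring : ∀ c z o n → c ℤ.+ (z ℤ.+ o) ℤ.* n ≡ o ℤ.* n ℤ.+ (c ℤ.+ z ℤ.* n)
    ring = solve-∀

  module _ (Ws : List (List (Word N (suc d))))
           (sound : ∀ {i c} → AtLevel Ws i c → c ∈ C × Vec.sum (Vec.map toℕ c) ≡ i ℕ.* N)
           (complete : ∀ {c} → c ∈ C → ∃[ i ] AtLevel Ws i c) where

    encode-latticePoint : ∀ k .{{_ : NonZero k}} {p} → p ∈ˡ gradedPairs Ws (suc d) k →
      latticePoints k Δ (encode k p)
    encode-latticePoint k {c , z} p∈ with i , c∈Wᵢ , i+∑z≡k ← ∈-gradedPairs⁻ Ws k p∈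
      with c∈C , ∑c≡iN ← sound c∈Wᵢ =
      conv⁺ (dilate k Δ) (λ j → offset k j ℤ.* + N) (k ℕ.* N) (dilate-axes k) {{ℕ.m*n≢0 k N}}
        digits ∑digits≡kN (encode k (c , z)) (lookup-encode k c z) ,
      aff⁺ (axis (+ N)) (λ _ → 0ℤ) N (λ i j → sym (ℤ.+-identityˡ (lookup (axis (+ N) i) j)))
        (λ j → offset k j ℤ.* + N ℤ.+ + digits j) ∑≡N (encode k (c , z))
        (λ j → trans (lookup-encode k c z j) (sym (ℤ.+-identityˡ (offset k j ℤ.* + N ℤ.+ + digits j)))) ,
      subst (_∈ C) (sym (π-encode k c z)) c∈C
      where
      digits : Fin (suc d) → ℕ
      digits j = toℕ (lookup c j) ℕ.+ lookup z j ℕ.* N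
      ∑digits≡kN : Σℤ.sum (λ j → + digits j) ≡ + (k ℕ.* N)
      ∑digits≡kN = trans (Σℤ-digits c z) (cong +_ (trans (cong (ℕ._+ Vec.sum z ℕ.* N) ∑c≡iN)
        (trans (sym (ℕ.*-distribʳ-+ N i (Vec.sum z))) (cong (ℕ._* N) i+∑z≡k))))
      ∑≡N : Σℤ.sum (λ j → offset k j ℤ.* + N ℤ.+ + digits j) ≡ + N
      ∑≡N = trans (Σℤ.∑-distrib-+ (λ j → offset k j ℤ.* + N) (λ j → + digits j))
        (trans (cong₂ ℤ._+_ (Σℤ-offset k) (trans ∑digits≡kN (ℤ.pos-* k N))) (ring (+ k) (+ N)))
        where
        ring : ∀ k n → (1ℤ ℤ.- k) ℤ.* n ℤ.+ k ℤ.* n ≡ n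
        ring = solve-∀

    decode : ∀ k {x} (y : Fin (suc d) → ℕ) → Σℤ.sum (λ j → + y j) ≡ + (k ℕ.* N) →
      (∀ j → lookup x j ≡ offset k j ℤ.* + N ℤ.+ + y j) → π x ∈ C →
      ∃[ p ] p ∈ˡ gradedPairs Ws (suc d) k × x ≡ encode k p
    decode k {x} y ∑y≡kN x≡ πx∈C =
      (c , z) , subst (λ k′ → (c , z) ∈ˡ gradedPairs Ws (suc d) k′) i+∑z≡k (∈-gradedPairs⁺ Ws i z c∈Wᵢ) , x≡encode
      where
      c : Word N (suc d)
      c = tabulate (λ j → y j mod N)
      z : Vec ℕ (suc d)
      z = tabulate (λ j → y j / N)
      digits≡y : ∀ j → toℕ (lookup c j) ℕ.+ lookup z j ℕ.* N ≡ y j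
      digits≡y j = trans (cong₂ (λ a b → toℕ a ℕ.+ b ℕ.* N)
        (lookup∘tabulate (λ j → y j mod N) j) (lookup∘tabulate (λ j → y j / N) j))
        (trans (cong (ℕ._+ y j / N ℕ.* N) (toℕ-fromℕ< (m%n<n (y j) N))) (sym (m≡m%n+[m/n]*n (y j) N)))
      x≡encode : x ≡ encode k (c , z)
      x≡encode = lookup-injective λ j → trans (x≡ j)
        (trans (cong (λ a → offset k j ℤ.* + N ℤ.+ + a) (sym (digits≡y j))) (sym (lookup-encode k c z j)))
      level : ∃[ i ] AtLevel Ws i c
      level = complete (subst (_∈ C) (trans (cong π x≡encode) (π-encode k c z)) πx∈C)
      i = proj₁ level
      c∈Wᵢ = proj₂ level
      i+∑z≡k : i ℕ.+ Vec.sum z ≡ k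
      i+∑z≡k = ℕ.*-cancelʳ-≡ (i ℕ.+ Vec.sum z) k N (trans (ℕ.*-distribʳ-+ N i (Vec.sum z))
        (trans (cong (ℕ._+ Vec.sum z ℕ.* N) (sym (proj₂ (sound c∈Wᵢ))))
          (ℤ.+-injective (trans (sym (Σℤ-digits c z)) (trans (Σℤ.sum-cong-≗ (λ j → cong +_ (digits≡y j))) ∑y≡kN)))))

    decode-latticePoint : ∀ k {x} → latticePoints k Δ x →
      ∃[ p ] p ∈ˡ gradedPairs Ws (suc d) k × x ≡ encode k p
    decode-latticePoint k {x} (x∈kΔ , _ , πx∈C) =
      let y , ∑y≡kN , x≡ = conv⁻ (dilate k Δ) (λ j → offset k j ℤ.* + N) (k ℕ.* N) (dilate-axes k) x x∈kΔ
      in decode k y ∑y≡kN x≡ πx∈C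

    hasHStar : All Unique Ws → ehrhart (List.map length Ws) (suc d) 0 ≡ 1 →
      HasHStar Δ (List.map +_ (List.map length Ws))
    hasHStar uniques ehrhart₀≡1 =
      ehrhart (List.map length Ws) (suc d) , ehrhart₀≡1 , cardinality , ehrhart-⊛-[1-t]^ (List.map length Ws) (suc d)
      where
      level-unique : ∀ {i j c} → AtLevel Ws i c → AtLevel Ws j c → i ≡ j
      level-unique p q = ℕ.*-cancelʳ-≡ _ _ N (trans (sym (proj₂ (sound p))) (proj₂ (sound q)))
      cardinality : ∀ k → 1 ℕ.≤ k → HasCardinality (latticePoints k Δ) (ehrhart (List.map length Ws) (suc d) k)
      cardinality k@(suc _) _ = List.map (encode k) (gradedPairs Ws (suc d) k) ,
        Unique.map⁺ (encode-injective k) (gradedPairs-unique Ws (suc d) k uniques level-unique) ,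
        (λ x → mk⇔ (λ x∈ → to (∈-map⁻ (encode k) x∈)) (from ∘ decode-latticePoint k)) ,
        trans (length-map (encode k) (gradedPairs Ws (suc d) k)) (length-gradedPairs Ws (suc d) k)
        where
        to : ∀ {x} → ∃[ p ] p ∈ˡ gradedPairs Ws (suc d) k × x ≡ encode k p → latticePoints k Δ x
        to (p , p∈ , refl) = encode-latticePoint k p∈
        from : ∀ {x} → ∃[ p ] p ∈ˡ gradedPairs Ws (suc d) k × x ≡ encode k p →
          x ∈ˡ List.map (encode k) (gradedPairs Ws (suc d) k)
        from (p , p∈ , refl) = ∈-map⁺ (encode k) p∈

-- The words of codeG

-- A word of codeG is determined by the parity a of κ₂, the parity c of κ₁ and s = c + 2j.
Index : ℕ → Set
Index m = Fin 2 × Fin 2 × Fin m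

height : ∀ {m} → Index m → ℕ
height (0F , 0F , zero)  = 0
height (1F , 0F , zero)  = 1
height (0F , 0F , suc _) = 1
height (1F , 0F , suc _) = 2
height (_  , 1F , _)     = 2

family : ∀ {l m} → Fin 2 → Fin 2 → (Fin l → Fin m) → List (Index m)
family {l} a c f = List.map (λ j → a , c , f j) (allFin l)

indices : ∀ m → List (List (Index (suc m)))
indices m =
  ((0F , 0F , zero) ∷ []) ∷
  ((1F , 0F , zero) ∷ family 0F 0F suc) ∷
  (family {m} 1F 0F suc ++ family {suc m} 0F 1F id ++ family {suc m} 1F 1F id) ∷
  []

indices-sound : ∀ m {i x} → AtLevel (indices m) i x → height x ≡ i
indices-sound m {0} (here refl) = refl
indices-sound m {1} (here refl) = refl
indices-sound m {1} (there p) with _ , _ , refl ← ∈-map⁻ _ p = refl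
indices-sound m {2} p with ∈-++⁻ (family {m} 1F 0F suc) p
... | inj₁ q with _ , _ , refl ← ∈-map⁻ _ q = refl
... | inj₂ q with ∈-++⁻ (family {suc m} 0F 1F id) q
...   | inj₁ r with _ , _ , refl ← ∈-map⁻ _ r = refl
...   | inj₂ r with _ , _ , refl ← ∈-map⁻ _ r = refl

indices-complete : ∀ m x → AtLevel (indices m) (height x) x
indices-complete m (0F , 0F , zero)  = here refl
indices-complete m (1F , 0F , zero)  = here refl
indices-complete m (0F , 0F , suc j) = there (∈-map⁺ _ (∈-allFin j))
indices-complete m (1F , 0F , suc j) = ∈-++⁺ˡ (∈-map⁺ _ (∈-allFin j))
indices-complete m (0F , 1F , j)     =
  ∈-++⁺ʳ (family {m} 1F 0F suc) (∈-++⁺ˡ (∈-map⁺ _ (∈-allFin j)))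
indices-complete m (1F , 1F , j)     =
  ∈-++⁺ʳ (family {m} 1F 0F suc) (∈-++⁺ʳ (family {suc m} 0F 1F id) (∈-map⁺ _ (∈-allFin j)))

indices-unique : ∀ m → All Unique (indices m)
indices-unique m =
  (All.[] AllPairs.∷ AllPairs.[]) All.∷
  (All.tabulate notHead AllPairs.∷ Unique.map⁺ (λ { refl → refl }) (Unique.allFin⁺ m)) All.∷
  Unique.++⁺ (Unique.map⁺ (λ { refl → refl }) (Unique.allFin⁺ m))
    (Unique.++⁺ (Unique.map⁺ (λ { refl → refl }) (Unique.allFin⁺ (suc m)))
      (Unique.map⁺ (λ { refl → refl }) (Unique.allFin⁺ (suc m)))
      λ { (p , q) → disjoint₂ p q })
    (λ { (p , q) → disjoint₁ p q }) All.∷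
  All.[]
  where
  notHead : ∀ {x : Index (suc m)} → x ∈ˡ family {m} 0F 0F suc → ¬ (1F , 0F , zero) ≡ x
  notHead p refl with ∈-map⁻ _ p
  ... | _ , _ , ()
  disjoint₂ : ∀ {x : Index (suc m)} → x ∈ˡ family {suc m} 0F 1F id →
    ¬ x ∈ˡ family {suc m} 1F 1F id
  disjoint₂ p q with ∈-map⁻ _ p | ∈-map⁻ _ q
  ... | _ , _ , refl | _ , _ , ()
  disjoint₁ : ∀ {x : Index (suc m)} → x ∈ˡ family {m} 1F 0F suc →
    ¬ x ∈ˡ family {suc m} 0F 1F id ++ family {suc m} 1F 1F id
  disjoint₁ p q with ∈-map⁻ _ p | ∈-++⁻ (family {suc m} 0F 1F id) q
  ... | _ , _ , refl | inj₁ r with () ← proj₂ (proj₂ (∈-map⁻ _ r))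
  ... | _ , _ , refl | inj₂ r with () ← proj₂ (proj₂ (∈-map⁻ _ r))

length-family : ∀ {l m} a c (f : Fin l → Fin m) → length (family a c f) ≡ l
length-family {l} a c f = trans (length-map (λ j → a , c , f j) (allFin l)) (length-tabulate id)

length-indices : ∀ m → List.map length (indices m) ≡ 1 ∷ suc m ∷ m ℕ.+ (suc m ℕ.+ suc m) ∷ []
length-indices m = cong₂ (λ k l → 1 ∷ suc k ∷ l ∷ []) (length-family {m} 0F 0F suc)
  (trans (length-++ (family {m} 1F 0F suc)) (cong₂ ℕ._+_ (length-family {m} 1F 0F suc)
    (trans (length-++ (family {suc m} 0F 1F id))
      (cong₂ ℕ._+_ (length-family {suc m} 0F 1F id) (length-family {suc m} 1F 1F id)))))

AtLevel-map⁺ : ∀ {A B : Set} (f : A → B) (Ws : List (List A)) i {a} → AtLevel Ws i a →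
  AtLevel (List.map (List.map f) Ws) i (f a)
AtLevel-map⁺ f (W ∷ Ws) zero    p = ∈-map⁺ f p
AtLevel-map⁺ f (W ∷ Ws) (suc i) p = AtLevel-map⁺ f Ws i p

AtLevel-map⁻ : ∀ {A B : Set} (f : A → B) (Ws : List (List A)) i {b} →
  AtLevel (List.map (List.map f) Ws) i b → ∃[ a ] AtLevel Ws i a × b ≡ f a
AtLevel-map⁻ f (W ∷ Ws) zero    p = ∈-map⁻ f p
AtLevel-map⁻ f (W ∷ Ws) (suc i) p = AtLevel-map⁻ f Ws i p

map-map-unique : ∀ {A B : Set} {f : A → B} → (∀ {x y} → f x ≡ f y → x ≡ y) →
  ∀ {Ws} → All Unique Ws → All Unique (List.map (List.map f) Ws)
map-map-unique inj All.[]       = All.[]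
map-map-unique inj (u All.∷ us) = Unique.map⁺ inj u All.∷ map-map-unique inj us

map-length-map : ∀ {A B : Set} (f : A → B) (Ws : List (List A)) →
  List.map length (List.map (List.map f) Ws) ≡ List.map length Ws
map-length-map f []       = refl
map-length-map f (W ∷ Ws) = cong₂ _∷_ (length-map f W) (map-length-map f Ws)

module CodeG (N : ℕ) .{{_ : NonZero N}} (2∣N : 2 ∣ N) (m : ℕ) (N/2≡1+m : N / 2 ≡ suc m) where

  open Even N 2∣N

  M : ℕ
  M = suc m

  N≡M*2 : N ≡ M ℕ.* 2
  N≡M*2 = trans (sym (m/n*n≡m 2∣N)) (cong (ℕ._* 2) N/2≡1+m)

  M₂≡M : M₂ ≡ + M
  M₂≡M = cong +_ N/2≡1+m

  M<N : M < N
  M<N = subst (M <_) (sym N≡M*2) (ℕ.m<m*n M 2 (s≤s (s≤s z≤n)))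

  fourth : Index M → ℕ
  fourth (_ , c , j) = toℕ c ℕ.+ toℕ j ℕ.* 2

  fourth<N : ∀ x → fourth x < N
  fourth<N (_ , c , j) = subst (fourth (c , c , j) <_) (sym N≡M*2)
    (ℕ.≤-trans (ℕ.+-monoˡ-< (toℕ j ℕ.* 2) (toℕ<n c)) (ℕ.*-monoˡ-≤ 2 (toℕ<n j)))

  word : Index M → Word N 5
  word x@(a , c , _) = π (point (+ toℕ c) (+ toℕ a) (+ fourth x))

  halfSum : Fin 2 → Fin 2 → ℕ
  halfSum 0F 0F = 0
  halfSum 0F 1F = M
  halfSum 1F 0F = M
  halfSum 1F 1F = 0

  negation : ℕ → ℕ
  negation zero    = 0
  negation (suc s) = N ∸ suc s

  values : Index M → Vec ℕ 5
  values x@(a , c , _) = halfSum c a ∷ toℕ a ℕ.* M ∷ toℕ c ℕ.* M ∷ fourth x ∷ negation (fourth x) ∷ []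

  map-toℕ-word : ∀ x → Vec.map toℕ (word x) ≡ values x
  map-toℕ-word x@(a , c , _) =
    cong₂ _∷_ (first c a) (cong₂ _∷_ (half a) (cong₂ _∷_ (half c)
      (cong₂ _∷_ (small (fourth<N x) refl) (cong (_∷ []) (fifth (fourth x) (fourth<N x))))))
    where
    small : ∀ {i r} → r < N → i ≡ + r → toℕ (residue {N} i) ≡ r
    small {i} r<N i≡r = toℕ-residue-unique {i = i} 0ℤ r<N (trans i≡r (sym (ℤ.+-identityʳ _)))
    0<N : 0 < N
    0<N = ℕ.≤-<-trans z≤n M<N
    half : ∀ b → toℕ (residue {N} (M₂ ℤ.* + toℕ b)) ≡ toℕ b ℕ.* M
    half b = small (half<N b) (trans (cong (ℤ._* + toℕ b) M₂≡M)
      (trans (ℤ.*-comm (+ M) (+ toℕ b)) (sym (ℤ.pos-* (toℕ b) M))))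
      where
      half<N : ∀ (b : Fin 2) → toℕ b ℕ.* M < N
      half<N 0F = 0<N
      half<N 1F = subst (_< N) (sym (ℕ.*-identityˡ M)) M<N
    first : ∀ c a → toℕ (residue {N} (M₂ ℤ.* (+ toℕ c ℤ.+ + toℕ a))) ≡ halfSum c a
    first 0F 0F = small 0<N (ℤ.*-zeroʳ M₂)
    first 0F 1F = small M<N (trans (ℤ.*-identityʳ M₂) M₂≡M)
    first 1F 0F = small M<N (trans (ℤ.*-identityʳ M₂) M₂≡M)
    first 1F 1F = toℕ-residue-unique {i = M₂ ℤ.* + 2} 1ℤ 0<N
      (trans (sym N≡M₂*2) (sym (trans (ℤ.+-identityˡ _) (ℤ.*-identityˡ (+ N)))))
    fifth : ∀ s → s < N → toℕ (residue {N} (ℤ.- + s)) ≡ negation s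
    fifth zero    _   = small 0<N refl
    fifth (suc s) s<N = toℕ-residue-unique {i = ℤ.- + suc s} -1ℤ (ℕ.∸-monoʳ-< (s≤s z≤n) (ℕ.<⇒≤ s<N))
      (trans (ring (+ suc s) (+ N)) (cong (ℤ._+ -1ℤ ℤ.* + N)
        (trans (ℤ.m-n≡m⊖n N (suc s)) (ℤ.⊖-≥ (ℕ.<⇒≤ s<N)))))
      where
      ring : ∀ s n → ℤ.- s ≡ n ℤ.- s ℤ.+ -1ℤ ℤ.* n
      ring = solve-∀

  sum-word : ∀ x → Vec.sum (Vec.map toℕ (word x)) ≡ height x ℕ.* N
  sum-word x = trans (cong Vec.sum (map-toℕ-word x)) (sum-values x)
    where
    s+negation : ∀ s → 0 < s → s < N → s ℕ.+ (negation s ℕ.+ 0) ≡ N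
    s+negation (suc s) _ s<N = trans (cong (suc s ℕ.+_) (ℕ.+-identityʳ _)) (ℕ.m+[n∸m]≡n (ℕ.<⇒≤ s<N))
    N≡M+M : N ≡ M ℕ.+ M
    N≡M+M = trans N≡M*2 (ring M)
      where
      ring : ∀ k → k ℕ.* 2 ≡ k ℕ.+ k
      ring = ℕsolve-∀
    two : ∀ {t} → t ≡ N → M ℕ.+ (M ℕ.+ t) ≡ 2 ℕ.* N
    two refl = trans (sym (ℕ.+-assoc M M N)) (cong₂ ℕ._+_ (sym N≡M+M) (sym (ℕ.+-identityʳ N)))
    1*M : 1 ℕ.* M ≡ M
    1*M = ℕ.*-identityˡ M
    sum-values : ∀ x → Vec.sum (values x) ≡ height x ℕ.* N
    sum-values (0F , 0F , zero)    = refl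
    sum-values (1F , 0F , zero)    =
      trans (cong (λ k → M ℕ.+ (k ℕ.+ 0)) 1*M) (trans (cong (M ℕ.+_) (ℕ.+-identityʳ M))
        (trans (sym N≡M+M) (sym (ℕ.+-identityʳ N))))
    sum-values x@(0F , 0F , suc _) =
      trans (s+negation (fourth x) (s≤s z≤n) (fourth<N x)) (sym (ℕ.+-identityʳ N))
    sum-values x@(1F , 0F , suc _) = trans (cong (λ k → M ℕ.+ (k ℕ.+ (fourth x ℕ.+ (negation (fourth x) ℕ.+ 0)))) 1*M)
      (two (s+negation (fourth x) (s≤s z≤n) (fourth<N x)))
    sum-values x@(0F , 1F , _)     = trans (cong (λ k → M ℕ.+ (k ℕ.+ (fourth x ℕ.+ (negation (fourth x) ℕ.+ 0)))) 1*M)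
      (two (s+negation (fourth x) (s≤s z≤n) (fourth<N x)))
    sum-values x@(1F , 1F , _)     =
      trans (cong₂ (λ k l → k ℕ.+ (l ℕ.+ (fourth x ℕ.+ (negation (fourth x) ℕ.+ 0)))) 1*M 1*M)
        (two (s+negation (fourth x) (s≤s z≤n) (fourth<N x)))

  word-injective : ∀ {x y} → word x ≡ word y → x ≡ y
  word-injective {x@(a , c , j)} {y@(a′ , c′ , j′)} eq =
    cong₂ _,_ (toℕ-injective (ℕ.*-cancelʳ-≡ (toℕ a) (toℕ a′) M (at 1F)))
      (cong₂ _,_ c≡c′ (toℕ-injective (ℕ.*-cancelʳ-≡ (toℕ j) (toℕ j′) 2
        (ℕ.+-cancelˡ-≡ (toℕ c) _ _ (trans (at (suc (suc 1F))) (cong (λ b → toℕ b ℕ.+ toℕ j′ ℕ.* 2) (sym c≡c′)))))))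
    where
    at : ∀ i → lookup (values x) i ≡ lookup (values y) i
    at i = cong (λ v → lookup v i) (trans (sym (map-toℕ-word x)) (trans (cong (Vec.map toℕ) eq) (map-toℕ-word y)))
    c≡c′ : c ≡ c′
    c≡c′ = toℕ-injective (ℕ.*-cancelʳ-≡ (toℕ c) (toℕ c′) M (at (suc 1F)))

  word∈codeG : ∀ x → word x ∈ codeG N
  word∈codeG x@(a , c , j) = Equivalence.from (codeG⇔ (word x))
    (+ toℕ c , + toℕ a , + fourth x , ℤ.- + toℕ j ,
      trans (ring (+ toℕ c) (+ toℕ a) (+ toℕ j)) (cong (ℤ._+ ℤ.- + toℕ j ℤ.* + 2) (sym fourth≡)) , refl)
    where
    fourth≡ : + fourth x ≡ + toℕ c ℤ.+ + toℕ j ℤ.* + 2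
    fourth≡ = trans (ℤ.pos-+ (toℕ c) (toℕ j ℕ.* 2)) (cong (ℤ._+_ (+ toℕ c)) (ℤ.pos-* (toℕ j) 2))
    ring : ∀ c a j → c ℤ.* 1ℤ ℤ.+ a ℤ.* 0ℤ ≡ c ℤ.+ j ℤ.* + 2 ℤ.+ ℤ.- j ℤ.* + 2
    ring = solve-∀

  codeG⊆words : ∀ {w} → w ∈ codeG N → ∃[ x ] w ≡ word x
  codeG⊆words {w} w∈C = fromParityWord (Equivalence.to (codeG⇔ w) w∈C)
    where
    fromParityWord : ParityWord 1ℤ 0ℤ w → ∃[ x ] w ≡ word x
    fromParityWord (κ₁ , κ₂ , s , q , eq , w≡) =
      x , trans w≡ (π-cong (point κ₁ κ₂ s) (point (+ toℕ c) (+ toℕ a) (+ fourth x))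
        (κ₁/2 ℤ.+ κ₂/2 ⟨ trans (cong₂ (λ k l → M₂ ℤ.* (k ℤ.+ l)) κ₁≡ κ₂≡) (ring₀ (+ toℕ c) (+ toℕ a) κ₁/2 κ₂/2 M₂) ⟩∷
         κ₂/2 ⟨ trans (cong (M₂ ℤ.*_) κ₂≡) (ring₁ (+ toℕ a) κ₂/2 M₂) ⟩∷
         κ₁/2 ⟨ trans (cong (M₂ ℤ.*_) κ₁≡) (ring₁ (+ toℕ c) κ₁/2 M₂) ⟩∷
         s/N ⟨ s≡ ⟩∷
         ℤ.- s/N ⟨ trans (cong ℤ.-_ s≡) (ring₂ (+ fourth x) s/N (M₂ ℤ.* + 2)) ⟩∷ []))
      where
      r : ℕ
      r = s %ℕ N
      s/N κ₁/2 κ₂/2 : ℤ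
      s/N = s /ℕ N
      a c : Fin 2
      a = fromℕ< (n%ℕd<d κ₂ 2)
      c = fromℕ< (m%n<n r 2)
      j : Fin M
      j = fromℕ< (m<n*o⇒m/o<n {r} {M} {2} (subst (r <_) N≡M*2 (n%ℕd<d s N)))
      x : Index M
      x = a , c , j
      κ₁/2 = + toℕ j ℤ.+ s/N ℤ.* M₂ ℤ.+ q
      κ₂/2 = κ₂ /ℕ 2
      κ₂≡ : κ₂ ≡ + toℕ a ℤ.+ κ₂/2 ℤ.* + 2
      κ₂≡ = trans (a≡a%ℕn+[a/ℕn]*n κ₂ 2) (cong (λ k → + k ℤ.+ κ₂/2 ℤ.* + 2) (sym (toℕ-fromℕ< (n%ℕd<d κ₂ 2))))
      r≡ : r ≡ fourth x
      r≡ = trans (m≡m%n+[m/n]*n r 2) (cong₂ (λ k l → k ℕ.+ l ℕ.* 2)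
        (sym (toℕ-fromℕ< (m%n<n r 2)))
        (sym (toℕ-fromℕ< (m<n*o⇒m/o<n {r} {M} {2} (subst (r <_) N≡M*2 (n%ℕd<d s N))))))
      s≡ : s ≡ + fourth x ℤ.+ s/N ℤ.* (M₂ ℤ.* + 2)
      s≡ = trans (a≡a%ℕn+[a/ℕn]*n s N) (cong₂ (λ k n → + k ℤ.+ s/N ℤ.* n) r≡ N≡M₂*2)
      κ₁≡ : κ₁ ≡ + toℕ c ℤ.+ κ₁/2 ℤ.* + 2
      κ₁≡ = trans (ring κ₁ κ₂) (trans eq (trans (cong (ℤ._+ q ℤ.* + 2) (trans s≡ (cong (ℤ._+ s/N ℤ.* (M₂ ℤ.* + 2))
        (trans (ℤ.pos-+ (toℕ c) (toℕ j ℕ.* 2)) (cong (ℤ._+_ (+ toℕ c)) (ℤ.pos-* (toℕ j) 2))))))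
        (ring′ (+ toℕ c) (+ toℕ j) s/N M₂ q)))
        where
        ring : ∀ κ₁ κ₂ → κ₁ ≡ κ₁ ℤ.* 1ℤ ℤ.+ κ₂ ℤ.* 0ℤ
        ring = solve-∀
        ring′ : ∀ c j t m q → c ℤ.+ j ℤ.* + 2 ℤ.+ t ℤ.* (m ℤ.* + 2) ℤ.+ q ℤ.* + 2 ≡
          c ℤ.+ (j ℤ.+ t ℤ.* m ℤ.+ q) ℤ.* + 2
        ring′ = solve-∀
      ring₀ : ∀ c a k l m → m ℤ.* (c ℤ.+ k ℤ.* + 2 ℤ.+ (a ℤ.+ l ℤ.* + 2)) ≡
        m ℤ.* (c ℤ.+ a) ℤ.+ (k ℤ.+ l) ℤ.* (m ℤ.* + 2)
      ring₀ = solve-∀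
      ring₁ : ∀ a k m → m ℤ.* (a ℤ.+ k ℤ.* + 2) ≡ m ℤ.* a ℤ.+ k ℤ.* (m ℤ.* + 2)
      ring₁ = solve-∀
      ring₂ : ∀ s t n → ℤ.- (s ℤ.+ t ℤ.* n) ≡ ℤ.- s ℤ.+ ℤ.- t ℤ.* n
      ring₂ = solve-∀

  codeG-zeroSums : HasZeroSums (codeG N)
  codeG-zeroSums w w∈C =
    let x , w≡ = codeG⊆words w∈C
    in divides (height x) (trans (cong (λ v → Vec.sum (Vec.map toℕ v)) w≡) (sum-word x))

  levels : List (List (Word N 5))
  levels = List.map (List.map word) (indices m)

  codeG-hStar : HasHStar (simplexOf (codeG N) codeG-zeroSums) (1ℤ ∷ + (N / 2) ∷ + (3 ℕ.* N / 2) ℤ.- 1ℤ ∷ [])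
  codeG-hStar = subst (HasHStar (simplexOf (codeG N) codeG-zeroSums)) coefficients
    (hasHStar (codeG N) codeG-zeroSums levels (λ {i} → sound {i}) complete
      (map-map-unique word-injective (indices-unique m)) refl)
    where
    sound : ∀ {i w} → AtLevel levels i w → w ∈ codeG N × Vec.sum (Vec.map toℕ w) ≡ i ℕ.* N
    sound {i} p =
      let x , x∈ , w≡ = AtLevel-map⁻ word (indices m) i p
      in subst (_∈ codeG N) (sym w≡) (word∈codeG x) ,
        trans (cong (λ v → Vec.sum (Vec.map toℕ v)) w≡)
          (trans (sum-word x) (cong (ℕ._* N) (indices-sound m {i} x∈)))
    complete : ∀ {w} → w ∈ codeG N → ∃[ i ] AtLevel levels i w
    complete w∈C =
      let x , w≡ = codeG⊆words w∈C
      in height x , subst (AtLevel levels (height x)) (sym w≡)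
        (AtLevel-map⁺ word (indices m) (height x) (indices-complete m x))
    3N/2≡3M : 3 ℕ.* N / 2 ≡ 3 ℕ.* M
    3N/2≡3M = trans (cong (λ n → 3 ℕ.* n / 2) N≡M*2)
      (trans (cong (_/ 2) (sym (ℕ.*-assoc 3 M 2))) (m*n/n≡m (3 ℕ.* M) 2))
    coefficients : List.map +_ (List.map length levels) ≡ 1ℤ ∷ + (N / 2) ∷ + (3 ℕ.* N / 2) ℤ.- 1ℤ ∷ []
    coefficients = trans (cong (List.map +_) (trans (map-length-map word (indices m)) (length-indices m)))
      (cong₂ (λ k l → 1ℤ ∷ + k ∷ l ∷ []) (sym N/2≡1+m)
        (trans (cong (λ k → + (m ℕ.+ (M ℕ.+ k))) (sym (ℕ.+-identityʳ M))) (cong (λ k → + k ℤ.- 1ℤ) (sym 3N/2≡3M))))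

lemma3p9 : (N : ℕ) .{{_ : NonZero N}} → 2 ≤ N → 2 ∣ N →
    ((b₁ b₂ : Fin N) → ¬ (toℕ b₁ ≡ 0 × toℕ b₂ ≡ 0) →
    gcd (gcd (toℕ b₁) (toℕ b₂)) (N / 2) ≡ 1 →
    IsDirectSum (codeOf N b₁ b₂) ⊎ codeOf N b₁ b₂ ≅ codeG N)
    × (Σ[ z ∈ HasZeroSums (codeG N) ]
    HasHStar (simplexOf (codeG N) z) (1ℤ ∷ + (N / 2) ∷ + (3 * N / 2) ℤ.- 1ℤ ∷ []))
lemma3p9 N 2≤N 2∣N = (λ b₁ b₂ _ → Even.classification N 2∣N b₁ b₂) , hStar (N / 2) refl (/-monoˡ-≤ 2 2≤N)
  where
  hStar : ∀ M → N / 2 ≡ M → 1 ≤ M → Σ[ z ∈ HasZeroSums (codeG N) ]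
    HasHStar (simplexOf (codeG N) z) (1ℤ ∷ + (N / 2) ∷ + (3 * N / 2) ℤ.- 1ℤ ∷ [])
  hStar (suc m) N/2≡M _ = CodeG.codeG-zeroSums N 2∣N m N/2≡M , CodeG.codeG-hStar N 2∣N m N/2≡M
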